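{- Let $G=(V,E)$ be a graph, $k\ge1$ an integer, and let $G_k$ be obtained from $G$ by performing a $k$-comb operation at every vertex of $G$. Let $p(k,u,x)=(1+x)^k(xu^2+1)-xu^2$. Then $$P(G_k;u,x)=p(k,u,x)^{|V|}\,P\big(G;u,\,x/p(k,u,x)\big)$$ (as an identity of rational functions; the right-hand side is a polynomial).
   Context: Graphs are finite, undirected, without multiple edges, self loops allowed; $G[A]$ is the induced subgraph on $A$, and $rk(G)$ is the $\mathbb{F}_2$-rank of the adjacency matrix ($m_{ij}=1$ iff $\{i,j\}\in E$, diagonal entry $1$ iff self loop; empty graph rank $0$). $P(G;u,x)=\sum_{A\subseteq V}x^{|A|}u^{rk(G[A])}$, with $0^0=1$. The $k$-comb of $G$ at a vertex $a$ is the graph $(V\cup\{a_1,\dots,a_k\},\,E\cup\{\{a,a_1\},\dots,\{a,a_k\}\})$ with $a_1,\dots,a_k$ new vertices (no self loops). $G_k$ is obtained by adding such a $k$-comb (with fresh new vertices) at each original vertex $a\in V$. -}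

module Defs where

open import Level using (0ℓ)
open import Algebra.Bundles using (CommutativeRing)
open import Algebra.Structures using (IsCommutativeRing)
open import Data.Bool.Base using (Bool; true; false; _∧_)
import Data.Bool.Properties as Boolₚ
open import Data.Fin.Base using (Fin; zero; suc; splitAt; _↑ˡ_)
import Data.Fin.Properties as Finₚ
open import Data.Fin.Subset using (Subset; inside; outside; ∣_∣)
open import Data.Fin.Subset.Properties using (anySubset?)
import Data.Integer.Properties as ℤₚ
open import Data.List.Base as List using (List; []; _∷_; _++_)
open import Data.List.Extrema.Nat using (max)
open import Data.Nat.Base as ℕ using (ℕ; zero; suc)
open import Data.Product.Base using (_,_)
open import Data.Sum.Base using (_⊎_; inj₁; inj₂; [_,_]′)
open import Data.Vec.Base as Vec using (Vec; []; _∷_; lookup)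
open import Function.Base using (_∘_)
open import Relation.Binary.PropositionalEquality.Core as ≡ using (_≡_)
open import Relation.Nullary.Decidable using (Dec; yes; no; does; ¬?; _→-dec_; decidable-stable)
open import Relation.Nullary.Negation using (¬_; contradiction)

-- 𝔽₂ is Bool with addition _xor_ and multiplication _∧_.
open import Algebra.Properties.CommutativeMonoid.Sum
  (CommutativeRing.+-commutativeMonoid Boolₚ.xor-∧-commutativeRing)
  using () renaming (sum to sum𝔽₂) public

Matrix : ℕ → ℕ → Set
Matrix m n = Fin m → Fin n → Bool

subsets : ∀ n → List (Subset n)
subsets zero    = [] ∷ []
subsets (suc n) = List.map (outside ∷_) (subsets n) ++ List.map (inside ∷_) (subsets n)

elements : ∀ {n} (S : Subset n) → Fin ∣ S ∣ → Fin n
elements (inside  ∷ S) zero    = zero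
elements (inside  ∷ S) (suc i) = suc (elements S i)
elements (outside ∷ S) i       = suc (elements S i)

VanishingCombination : ∀ {m n} → Matrix m n → Vec Bool m → Set
VanishingCombination r c = ∀ j → sum𝔽₂ (λ i → lookup c i ∧ r i j) ≡ false

LinearlyIndependent : ∀ {m n} → Matrix m n → Set
LinearlyIndependent r = ∀ c → VanishingCombination r c → ∀ i → lookup c i ≡ false

linearlyIndependent? : ∀ {m n} (r : Matrix m n) → Dec (LinearlyIndependent r)
linearlyIndependent? r with anySubset? (λ c → ¬? (trivial? c))
  where
  trivial? : ∀ c → Dec (VanishingCombination r c → ∀ i → lookup c i ≡ false)
  trivial? c = Finₚ.all? (λ j → sum𝔽₂ (λ i → lookup c i ∧ r i j) Boolₚ.≟ false)
         →-dec Finₚ.all? (λ i → lookup c i Boolₚ.≟ false)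
... | yes (c , ¬triv) = no λ li → ¬triv (li c)
... | no  ∄c          = yes λ c v i → decidable-stable (lookup c i Boolₚ.≟ false)
                          λ cᵢ≢0 → ∄c (c , λ triv → cᵢ≢0 (triv v i))

-- The largest number of linearly independent rows.
rank : ∀ {m n} → Matrix m n → ℕ
rank {m} M =
  max 0 (List.map ∣_∣ (List.filter (λ S → linearlyIndependent? (M ∘ elements S)) (subsets m)))

-- Adjacency matrices are symmetric; the diagonal is unconstrained, so self
-- loops are allowed.
record Graph (n : ℕ) : Set where
  field
    adj     : Matrix n n
    adj-sym : ∀ i j → adj i j ≡ adj j i

open Graph public

_[_] : ∀ {n} → Graph n → (A : Subset n) → Graph ∣ A ∣
(G [ A ]) .adj     i j = adj G (elements A i) (elements A j)
(G [ A ]) .adj-sym i j = adj-sym G (elements A i) (elements A j)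

rk : ∀ {n} → Graph n → ℕ
rk G = rank (adj G)

-- In Fin (n + k) the first n elements are the old vertices and the last k are
-- the new vertices a₁, …, a_k.
comb : ∀ {n} (k : ℕ) → Graph n → Fin n → Graph (n ℕ.+ k)
comb {n} k G a = record
  { adj     = λ i j → adj′ (splitAt n i) (splitAt n j)
  ; adj-sym = λ i j → adj′-sym (splitAt n i) (splitAt n j)
  }
  where
  adj′ : Fin n ⊎ Fin k → Fin n ⊎ Fin k → Bool
  adj′ (inj₁ i) (inj₁ j) = adj G i j
  adj′ (inj₁ i) (inj₂ _) = does (i Finₚ.≟ a)
  adj′ (inj₂ _) (inj₁ j) = does (j Finₚ.≟ a)
  adj′ (inj₂ _) (inj₂ _) = false

  adj′-sym : ∀ v w → adj′ v w ≡ adj′ w v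
  adj′-sym (inj₁ i) (inj₁ j) = adj-sym G i j
  adj′-sym (inj₁ _) (inj₂ _) = ≡.refl
  adj′-sym (inj₂ _) (inj₁ _) = ≡.refl
  adj′-sym (inj₂ _) (inj₂ _) = ≡.refl

combsOrder : ℕ → ℕ → ℕ → ℕ
combsOrder k n zero    = n
combsOrder k n (suc l) = combsOrder k (n ℕ.+ k) l

-- Performs the k-comb operation at each listed vertex in turn; after each step
-- the remaining vertices are re-indexed as old vertices of the larger graph.
combs : ∀ {n l} (k : ℕ) → Graph n → Vec (Fin n) l → Graph (combsOrder k n l)
combs k G []       = G
combs k G (a ∷ as) = combs k (comb k G a) (Vec.map (_↑ˡ k) as)

combEverywhere : ∀ {n} (k : ℕ) → Graph n → Graph (combsOrder k n n)
combEverywhere {n} k G = combs k G (Vec.allFin n)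

module Evaluation (R : CommutativeRing 0ℓ 0ℓ) where
  open CommutativeRing R
  open import Algebra.Properties.Semiring.Exp semiring using (_^_) public

  P : ∀ {n} → Graph n → Carrier → Carrier → Carrier
  P {n} G u x = List.foldr _+_ 0# (List.map (λ A → x ^ ∣ A ∣ * u ^ rk (G [ A ])) (subsets n))

  p : ℕ → Carrier → Carrier → Carrier
  p k u x = (1# + x) ^ k * (x * u ^ 2 + 1#) - x * u ^ 2

record IntegralDomain : Set₁ where
  field
    commutativeRing : CommutativeRing 0ℓ 0ℓ

  open CommutativeRing commutativeRing public

  field
    1≉0             : ¬ (1# ≈ 0#)
    noZeroDivisors  : ∀ a b → a * b ≈ 0# → a ≈ 0# ⊎ b ≈ 0#

ℤ-domain : IntegralDomain
ℤ-domain = record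
  { commutativeRing = ℤₚ.+-*-commutativeRing
  ; 1≉0             = λ ()
  ; noZeroDivisors  = λ a b → ℤₚ.i*j≡0⇒i≡0∨j≡0 a
  }

-- A polynomial is its list of coefficients, constant term first; trailing
-- zeros are identified away by _≈ₚ_.
module Polynomial (D : IntegralDomain) where
  open IntegralDomain D
  open import Algebra.Properties.Ring ring using (-0#≈0#)
  open import Algebra.Properties.CommutativeSemigroup +-commutativeSemigroup using (interchange)
  open import Relation.Binary.Reasoning.Setoid setoid

  Poly : Set
  Poly = List Carrier

  coeff : Poly → ℕ → Carrier
  coeff []      _       = 0#
  coeff (a ∷ f) zero    = a
  coeff (a ∷ f) (suc i) = coeff f i

  infix 4 _≈ₚ_
  record _≈ₚ_ (f g : Poly) : Set where
    constructor mk≈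
    field coeff-≈ : ∀ i → coeff f i ≈ coeff g i
  open _≈ₚ_ public

  constant : Carrier → Poly
  constant a = a ∷ []

  X : Poly
  X = 0# ∷ 1# ∷ []

  infixl 6 _+ₚ_
  _+ₚ_ : Poly → Poly → Poly
  []      +ₚ g       = g
  (a ∷ f) +ₚ []      = a ∷ f
  (a ∷ f) +ₚ (b ∷ g) = (a + b) ∷ (f +ₚ g)

  -ₚ_ : Poly → Poly
  -ₚ_ = List.map (λ a → - a)

  scale : Carrier → Poly → Poly
  scale a = List.map (a *_)

  infixl 7 _*ₚ_
  _*ₚ_ : Poly → Poly → Poly
  []      *ₚ g = []
  (a ∷ f) *ₚ g = scale a g +ₚ (0# ∷ f *ₚ g)

  coeff-+ : ∀ f g i → coeff (f +ₚ g) i ≈ coeff f i + coeff g i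
  coeff-+ []      g       i       = sym (+-identityˡ _)
  coeff-+ (a ∷ f) []      i       = sym (+-identityʳ _)
  coeff-+ (a ∷ f) (b ∷ g) zero    = refl
  coeff-+ (a ∷ f) (b ∷ g) (suc i) = coeff-+ f g i

  coeff-neg : ∀ f i → coeff (-ₚ f) i ≈ - coeff f i
  coeff-neg []      i       = sym -0#≈0#
  coeff-neg (a ∷ f) zero    = refl
  coeff-neg (a ∷ f) (suc i) = coeff-neg f i

  coeff-scale : ∀ a f i → coeff (scale a f) i ≈ a * coeff f i
  coeff-scale a []      i       = sym (zeroʳ a)
  coeff-scale a (b ∷ f) zero    = refl
  coeff-scale a (b ∷ f) (suc i) = coeff-scale a f i

  coeff₀-* : ∀ f g → coeff (f *ₚ g) 0 ≈ coeff f 0 * coeff g 0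
  coeff₀-* []      g = sym (zeroˡ _)
  coeff₀-* (a ∷ f) g = begin
    coeff (scale a g +ₚ (0# ∷ f *ₚ g)) 0 ≈⟨ coeff-+ (scale a g) (0# ∷ f *ₚ g) 0 ⟩
    coeff (scale a g) 0 + 0#             ≈⟨ +-identityʳ _ ⟩
    coeff (scale a g) 0                  ≈⟨ coeff-scale a g 0 ⟩
    a * coeff g 0                        ∎

  ≈ₚ-refl : ∀ {f} → f ≈ₚ f
  ≈ₚ-refl = mk≈ λ i → refl

  ≈ₚ-sym : ∀ {f g} → f ≈ₚ g → g ≈ₚ f
  ≈ₚ-sym (mk≈ e) = mk≈ λ i → sym (e i)

  ≈ₚ-trans : ∀ {f g h} → f ≈ₚ g → g ≈ₚ h → f ≈ₚ h
  ≈ₚ-trans (mk≈ e) (mk≈ e′) = mk≈ λ i → trans (e i) (e′ i)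

  ∷-cong : ∀ {a b f g} → a ≈ b → f ≈ₚ g → a ∷ f ≈ₚ b ∷ g
  ∷-cong a≈b (mk≈ e) = mk≈ λ { zero → a≈b ; (suc i) → e i }

  +ₚ-cong : ∀ {f f′ g g′} → f ≈ₚ f′ → g ≈ₚ g′ → f +ₚ g ≈ₚ f′ +ₚ g′
  +ₚ-cong {f} {f′} {g} {g′} (mk≈ e) (mk≈ e′) = mk≈ λ i →
    trans (coeff-+ f g i) (trans (+-cong (e i) (e′ i)) (sym (coeff-+ f′ g′ i)))

  -ₚ-cong : ∀ {f g} → f ≈ₚ g → -ₚ f ≈ₚ -ₚ g
  -ₚ-cong {f} {g} (mk≈ e) = mk≈ λ i →
    trans (coeff-neg f i) (trans (-‿cong (e i)) (sym (coeff-neg g i)))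

  scale-cong : ∀ {a b f g} → a ≈ b → f ≈ₚ g → scale a f ≈ₚ scale b g
  scale-cong {a} {b} {f} {g} a≈b (mk≈ e) = mk≈ λ i →
    trans (coeff-scale a f i) (trans (*-cong a≈b (e i)) (sym (coeff-scale b g i)))

  +ₚ-assoc : ∀ f g h → (f +ₚ g) +ₚ h ≈ₚ f +ₚ (g +ₚ h)
  +ₚ-assoc f g h = mk≈ λ i → begin
    coeff ((f +ₚ g) +ₚ h) i               ≈⟨ coeff-+ (f +ₚ g) h i ⟩
    coeff (f +ₚ g) i + coeff h i          ≈⟨ +-congʳ (coeff-+ f g i) ⟩
    (coeff f i + coeff g i) + coeff h i   ≈⟨ +-assoc _ _ _ ⟩
    coeff f i + (coeff g i + coeff h i)   ≈⟨ +-congˡ (coeff-+ g h i) ⟨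
    coeff f i + coeff (g +ₚ h) i          ≈⟨ coeff-+ f (g +ₚ h) i ⟨
    coeff (f +ₚ (g +ₚ h)) i               ∎

  +ₚ-comm : ∀ f g → f +ₚ g ≈ₚ g +ₚ f
  +ₚ-comm f g = mk≈ λ i →
    trans (coeff-+ f g i) (trans (+-comm _ _) (sym (coeff-+ g f i)))

  +ₚ-identityʳ : ∀ f → f +ₚ [] ≈ₚ f
  +ₚ-identityʳ f = +ₚ-comm f []

  -ₚ-inverseʳ : ∀ f → f +ₚ (-ₚ f) ≈ₚ []
  -ₚ-inverseʳ f = mk≈ λ i →
    trans (coeff-+ f (-ₚ f) i) (trans (+-congˡ (coeff-neg f i)) (-‿inverseʳ _))

  -ₚ-inverseˡ : ∀ f → (-ₚ f) +ₚ f ≈ₚ []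
  -ₚ-inverseˡ f = ≈ₚ-trans (+ₚ-comm (-ₚ f) f) (-ₚ-inverseʳ f)

  +ₚ-interchange : ∀ f g h k → (f +ₚ g) +ₚ (h +ₚ k) ≈ₚ (f +ₚ h) +ₚ (g +ₚ k)
  +ₚ-interchange f g h k = mk≈ λ i → begin
    coeff ((f +ₚ g) +ₚ (h +ₚ k)) i                      ≈⟨ coeff-+ (f +ₚ g) (h +ₚ k) i ⟩
    coeff (f +ₚ g) i + coeff (h +ₚ k) i                 ≈⟨ +-cong (coeff-+ f g i) (coeff-+ h k i) ⟩
    (coeff f i + coeff g i) + (coeff h i + coeff k i)   ≈⟨ interchange _ _ _ _ ⟩
    (coeff f i + coeff h i) + (coeff g i + coeff k i)   ≈⟨ +-cong (coeff-+ f h i) (coeff-+ g k i) ⟨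
    coeff (f +ₚ h) i + coeff (g +ₚ k) i                 ≈⟨ coeff-+ (f +ₚ h) (g +ₚ k) i ⟨
    coeff ((f +ₚ h) +ₚ (g +ₚ k)) i                      ∎

  0∷[]≈[] : 0# ∷ [] ≈ₚ []
  0∷[]≈[] = mk≈ λ { zero → refl ; (suc i) → refl }

  tail≈[] : ∀ {a f} → a ∷ f ≈ₚ [] → f ≈ₚ []
  tail≈[] (mk≈ e) = mk≈ λ i → e (suc i)

  ∷≈[] : ∀ {a f} → a ≈ 0# → f ≈ₚ [] → a ∷ f ≈ₚ []
  ∷≈[] a≈0 f≈[] = ≈ₚ-trans (∷-cong a≈0 f≈[]) 0∷[]≈[]

  scale-zero : ∀ {a} → a ≈ 0# → ∀ f → scale a f ≈ₚ []
  scale-zero {a} a≈0 f = mk≈ λ i →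
    trans (coeff-scale a f i) (trans (*-congʳ a≈0) (zeroˡ _))

  scale-one : ∀ f → scale 1# f ≈ₚ f
  scale-one f = mk≈ λ i → trans (coeff-scale 1# f i) (*-identityˡ _)

  scale-+ₚ : ∀ a f g → scale a (f +ₚ g) ≈ₚ scale a f +ₚ scale a g
  scale-+ₚ a f g = mk≈ λ i → begin
    coeff (scale a (f +ₚ g)) i                  ≈⟨ coeff-scale a (f +ₚ g) i ⟩
    a * coeff (f +ₚ g) i                        ≈⟨ *-congˡ (coeff-+ f g i) ⟩
    a * (coeff f i + coeff g i)                 ≈⟨ distribˡ a _ _ ⟩
    a * coeff f i + a * coeff g i               ≈⟨ +-cong (coeff-scale a f i) (coeff-scale a g i) ⟨
    coeff (scale a f) i + coeff (scale a g) i   ≈⟨ coeff-+ (scale a f) (scale a g) i ⟨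
    coeff (scale a f +ₚ scale a g) i            ∎

  scale-scale : ∀ a b f → scale (a * b) f ≈ₚ scale a (scale b f)
  scale-scale a b f = mk≈ λ i → begin
    coeff (scale (a * b) f) i       ≈⟨ coeff-scale (a * b) f i ⟩
    a * b * coeff f i               ≈⟨ *-assoc a b _ ⟩
    a * (b * coeff f i)             ≈⟨ *-congˡ (coeff-scale b f i) ⟨
    a * coeff (scale b f) i         ≈⟨ coeff-scale a (scale b f) i ⟨
    coeff (scale a (scale b f)) i   ∎

  *ₚ-congˡ : ∀ f {g g′} → g ≈ₚ g′ → f *ₚ g ≈ₚ f *ₚ g′
  *ₚ-congˡ []      e = ≈ₚ-refl
  *ₚ-congˡ (a ∷ f) e = +ₚ-cong (scale-cong refl e) (∷-cong refl (*ₚ-congˡ f e))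

  *ₚ-distribˡ : ∀ f g h → f *ₚ (g +ₚ h) ≈ₚ f *ₚ g +ₚ f *ₚ h
  *ₚ-distribˡ []      g h = ≈ₚ-refl
  *ₚ-distribˡ (a ∷ f) g h = ≈ₚ-trans
    (+ₚ-cong (scale-+ₚ a g h) (∷-cong (sym (+-identityʳ 0#)) (*ₚ-distribˡ f g h)))
    (+ₚ-interchange (scale a g) (scale a h) (0# ∷ f *ₚ g) (0# ∷ f *ₚ h))

  *ₚ-zeroʳ : ∀ f → f *ₚ [] ≈ₚ []
  *ₚ-zeroʳ []      = ≈ₚ-refl
  *ₚ-zeroʳ (a ∷ f) = ∷≈[] refl (*ₚ-zeroʳ f)

  *ₚ-∷ : ∀ f b g → f *ₚ (b ∷ g) ≈ₚ scale b f +ₚ (0# ∷ f *ₚ g)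
  *ₚ-∷ []      b g = ≈ₚ-sym 0∷[]≈[]
  *ₚ-∷ (a ∷ f) b g = ∷-cong (+-congʳ (*-comm a b))
    (≈ₚ-trans (+ₚ-cong (≈ₚ-refl {scale a g}) (*ₚ-∷ f b g))
    (≈ₚ-trans (≈ₚ-sym (+ₚ-assoc (scale a g) (scale b f) _))
    (≈ₚ-trans (+ₚ-cong (+ₚ-comm (scale a g) (scale b f)) ≈ₚ-refl)
              (+ₚ-assoc (scale b f) (scale a g) _))))

  *ₚ-comm : ∀ f g → f *ₚ g ≈ₚ g *ₚ f
  *ₚ-comm []      g = ≈ₚ-sym (*ₚ-zeroʳ g)
  *ₚ-comm (a ∷ f) g = ≈ₚ-trans
    (+ₚ-cong (≈ₚ-refl {scale a g}) (∷-cong refl (*ₚ-comm f g)))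
    (≈ₚ-sym (*ₚ-∷ g a f))

  *ₚ-cong : ∀ {f f′ g g′} → f ≈ₚ f′ → g ≈ₚ g′ → f *ₚ g ≈ₚ f′ *ₚ g′
  *ₚ-cong {f} {f′} {g} {g′} e e′ =
    ≈ₚ-trans (*ₚ-congˡ f e′)
    (≈ₚ-trans (*ₚ-comm f g′) (≈ₚ-trans (*ₚ-congˡ g′ e) (*ₚ-comm g′ f′)))

  *ₚ-distribʳ : ∀ f g h → (g +ₚ h) *ₚ f ≈ₚ g *ₚ f +ₚ h *ₚ f
  *ₚ-distribʳ f g h = ≈ₚ-trans (*ₚ-comm (g +ₚ h) f)
    (≈ₚ-trans (*ₚ-distribˡ f g h) (+ₚ-cong (*ₚ-comm f g) (*ₚ-comm f h)))

  0∷-*ₚ : ∀ f g → (0# ∷ f) *ₚ g ≈ₚ 0# ∷ f *ₚ g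
  0∷-*ₚ f g = +ₚ-cong (scale-zero refl g) ≈ₚ-refl

  scale-*ₚ : ∀ a f g → scale a f *ₚ g ≈ₚ scale a (f *ₚ g)
  scale-*ₚ a []      g = ≈ₚ-refl
  scale-*ₚ a (b ∷ f) g = ≈ₚ-trans
    (+ₚ-cong (scale-scale a b g) (∷-cong (sym (zeroʳ a)) (scale-*ₚ a f g)))
    (≈ₚ-sym (scale-+ₚ a (scale b g) (0# ∷ f *ₚ g)))

  *ₚ-assoc : ∀ f g h → (f *ₚ g) *ₚ h ≈ₚ f *ₚ (g *ₚ h)
  *ₚ-assoc []      g h = ≈ₚ-refl
  *ₚ-assoc (a ∷ f) g h = ≈ₚ-trans (*ₚ-distribʳ h (scale a g) (0# ∷ f *ₚ g))
    (+ₚ-cong (scale-*ₚ a g h)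
             (≈ₚ-trans (0∷-*ₚ (f *ₚ g) h) (∷-cong refl (*ₚ-assoc f g h))))

  *ₚ-identityˡ : ∀ f → constant 1# *ₚ f ≈ₚ f
  *ₚ-identityˡ f =
    ≈ₚ-trans (+ₚ-cong (scale-one f) 0∷[]≈[]) (+ₚ-identityʳ f)

  *ₚ-noZeroDivisors : ∀ f g → f *ₚ g ≈ₚ [] → f ≈ₚ [] ⊎ g ≈ₚ []
  *ₚ-noZeroDivisors []      g       e = inj₁ ≈ₚ-refl
  *ₚ-noZeroDivisors (a ∷ f) []      e = inj₂ ≈ₚ-refl
  *ₚ-noZeroDivisors (a ∷ f) (b ∷ g) e =
    [ (λ a≈0 → [ (λ f≈[] → inj₁ (∷≈[] a≈0 f≈[])) , inj₂ ]′
        (*ₚ-noZeroDivisors f (b ∷ g)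
          (≈ₚ-trans (+ₚ-cong (≈ₚ-sym (scale-zero a≈0 g)) ≈ₚ-refl) (tail≈[] e))))
    , (λ b≈0 → [ inj₁ , (λ g≈[] → inj₂ (∷≈[] b≈0 g≈[])) ]′
        (*ₚ-noZeroDivisors (a ∷ f) g
          (tail≈[] (≈ₚ-trans (+ₚ-cong (≈ₚ-sym (scale-zero b≈0 (a ∷ f))) ≈ₚ-refl)
                   (≈ₚ-trans (≈ₚ-sym (*ₚ-∷ (a ∷ f) b g)) e)))))
    ]′ (noZeroDivisors a b (trans (sym (+-identityʳ _)) (coeff-≈ e 0)))

  isCommutativeRingₚ : IsCommutativeRing _≈ₚ_ _+ₚ_ _*ₚ_ -ₚ_ [] (constant 1#)
  isCommutativeRingₚ = record
    { isRing = record
      { +-isAbelianGroup = record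
        { isGroup = record
          { isMonoid = record
            { isSemigroup = record
              { isMagma = record
                { isEquivalence = record { refl = ≈ₚ-refl ; sym = ≈ₚ-sym ; trans = ≈ₚ-trans }
                ; ∙-cong = +ₚ-cong
                }
              ; assoc = +ₚ-assoc
              }
            ; identity = (λ f → ≈ₚ-refl) , +ₚ-identityʳ
            }
          ; inverse = -ₚ-inverseˡ , -ₚ-inverseʳ
          ; ⁻¹-cong = -ₚ-cong
          }
        ; comm = +ₚ-comm
        }
      ; *-cong     = *ₚ-cong
      ; *-assoc    = *ₚ-assoc
      ; *-identity = *ₚ-identityˡ , λ f → ≈ₚ-trans (*ₚ-comm f (constant 1#)) (*ₚ-identityˡ f)
      ; distrib    = *ₚ-distribˡ , *ₚ-distribʳ
      }
    ; *-comm = *ₚ-comm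
    }

  polynomialDomain : IntegralDomain
  polynomialDomain = record
    { commutativeRing = record { isCommutativeRing = isCommutativeRingₚ }
    ; 1≉0             = λ e → 1≉0 (coeff-≈ e 0)
    ; noZeroDivisors  = *ₚ-noZeroDivisors
    }

module FieldOfFractions (D : IntegralDomain) where
  open IntegralDomain D
  open import Algebra.Properties.Ring ring using (x∙y⁻¹≈ε⇒x≈y; -‿distribˡ-*; [y-z]x≈yx-zx)
  open import Relation.Binary.Reasoning.Setoid setoid
  open import Algebra.Solver.Ring.NaturalCoefficients.Default commutativeSemiring using (solve; _:=_; _:+_; _:*_)

  infix 7 _/_⟨_⟩
  record Fraction : Set where
    constructor _/_⟨_⟩
    field
      num   : Carrier
      den   : Carrier
      den≉0 : ¬ (den ≈ 0#)
  open Fraction public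

  infix 4 _≈ᶠ_
  record _≈ᶠ_ (q r : Fraction) : Set where
    constructor mk≈ᶠ
    field cross : num q * den r ≈ num r * den q
  open _≈ᶠ_ public

  *-≉0 : ∀ {a b} → ¬ (a ≈ 0#) → ¬ (b ≈ 0#) → ¬ (a * b ≈ 0#)
  *-≉0 {a} {b} a≉0 b≉0 ab≈0 = [ a≉0 , b≉0 ]′ (noZeroDivisors a b ab≈0)

  *-cancelʳ : ∀ {a b} c → ¬ (c ≈ 0#) → a * c ≈ b * c → a ≈ b
  *-cancelʳ {a} {b} c c≉0 e = [ x∙y⁻¹≈ε⇒x≈y a b , (λ c≈0 → contradiction c≈0 c≉0) ]′
    (noZeroDivisors (a - b) c (begin
      (a - b) * c     ≈⟨ [y-z]x≈yx-zx c a b ⟩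
      a * c - b * c   ≈⟨ +-congʳ e ⟩
      b * c - b * c   ≈⟨ -‿inverseʳ _ ⟩
      0#              ∎))

  embed : Carrier → Fraction
  embed a = a / 1# ⟨ 1≉0 ⟩

  infixl 6 _+ᶠ_
  _+ᶠ_ : Fraction → Fraction → Fraction
  (a / b ⟨ b≉0 ⟩) +ᶠ (c / d ⟨ d≉0 ⟩) = (a * d + c * b) / b * d ⟨ *-≉0 b≉0 d≉0 ⟩

  infixl 7 _*ᶠ_
  _*ᶠ_ : Fraction → Fraction → Fraction
  (a / b ⟨ b≉0 ⟩) *ᶠ (c / d ⟨ d≉0 ⟩) = (a * c) / b * d ⟨ *-≉0 b≉0 d≉0 ⟩

  -ᶠ_ : Fraction → Fraction
  -ᶠ (a / b ⟨ b≉0 ⟩) = (- a) / b ⟨ b≉0 ⟩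

  ≈ᶠ-refl : ∀ {q} → q ≈ᶠ q
  ≈ᶠ-refl = mk≈ᶠ refl

  ≈ᶠ-sym : ∀ {q r} → q ≈ᶠ r → r ≈ᶠ q
  ≈ᶠ-sym (mk≈ᶠ e) = mk≈ᶠ (sym e)

  ≈ᶠ-trans : ∀ {q r s} → q ≈ᶠ r → r ≈ᶠ s → q ≈ᶠ s
  ≈ᶠ-trans {a / b ⟨ _ ⟩} {c / d ⟨ d≉0 ⟩} {e / f ⟨ _ ⟩} (mk≈ᶠ ad≈cb) (mk≈ᶠ cf≈ed) =
    mk≈ᶠ (*-cancelʳ d d≉0 (begin
      (a * f) * d   ≈⟨ swap a f d ⟩
      (a * d) * f   ≈⟨ *-congʳ ad≈cb ⟩
      (c * b) * f   ≈⟨ swap c b f ⟩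
      (c * f) * b   ≈⟨ *-congʳ cf≈ed ⟩
      (e * d) * b   ≈⟨ swap e d b ⟩
      (e * b) * d   ∎))
    where
    swap : ∀ x y z → (x * y) * z ≈ (x * z) * y
    swap = solve 3 (λ x y z → ((x :* y) :* z) := ((x :* z) :* y)) refl

  +ᶠ-cong : ∀ {q q′ r r′} → q ≈ᶠ q′ → r ≈ᶠ r′ → q +ᶠ r ≈ᶠ q′ +ᶠ r′
  +ᶠ-cong {a / b ⟨ _ ⟩} {a′ / b′ ⟨ _ ⟩} {c / d ⟨ _ ⟩} {c′ / d′ ⟨ _ ⟩} (mk≈ᶠ e) (mk≈ᶠ e′) =
    mk≈ᶠ (begin
      (a * d + c * b) * (b′ * d′)               ≈⟨ expand a b b′ c d d′ ⟩
      (a * b′) * (d * d′) + (c * d′) * (b * b′)   ≈⟨ +-cong (*-congʳ e) (*-congʳ e′) ⟩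
      (a′ * b) * (d * d′) + (c′ * d) * (b * b′)   ≈⟨ collect a′ b b′ c′ d d′ ⟩
      (a′ * d′ + c′ * b′) * (b * d)             ∎)
    where
    expand : ∀ a b b′ c d d′ →
      (a * d + c * b) * (b′ * d′) ≈ (a * b′) * (d * d′) + (c * d′) * (b * b′)
    expand = solve 6 (λ a b b′ c d d′ →
      ((a :* d :+ c :* b) :* (b′ :* d′)) := ((a :* b′) :* (d :* d′) :+ (c :* d′) :* (b :* b′))) refl
    collect : ∀ a b b′ c d d′ →
      (a * b) * (d * d′) + (c * d) * (b * b′) ≈ (a * d′ + c * b′) * (b * d)
    collect = solve 6 (λ a b b′ c d d′ →
      ((a :* b) :* (d :* d′) :+ (c :* d) :* (b :* b′)) := ((a :* d′ :+ c :* b′) :* (b :* d))) refl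

  *ᶠ-cong : ∀ {q q′ r r′} → q ≈ᶠ q′ → r ≈ᶠ r′ → q *ᶠ r ≈ᶠ q′ *ᶠ r′
  *ᶠ-cong {a / b ⟨ _ ⟩} {a′ / b′ ⟨ _ ⟩} {c / d ⟨ _ ⟩} {c′ / d′ ⟨ _ ⟩} (mk≈ᶠ e) (mk≈ᶠ e′) =
    mk≈ᶠ (begin
      (a * c) * (b′ * d′)     ≈⟨ regroup a c b′ d′ ⟩
      (a * b′) * (c * d′)     ≈⟨ *-cong e e′ ⟩
      (a′ * b) * (c′ * d)     ≈⟨ regroup a′ b c′ d ⟩
      (a′ * c′) * (b * d)     ∎)
    where
    regroup : ∀ w x y z → (w * x) * (y * z) ≈ (w * y) * (x * z)
    regroup = solve 4 (λ w x y z → ((w :* x) :* (y :* z)) := ((w :* y) :* (x :* z))) refl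

  -ᶠ-cong : ∀ {q r} → q ≈ᶠ r → -ᶠ q ≈ᶠ -ᶠ r
  -ᶠ-cong {a / b ⟨ _ ⟩} {c / d ⟨ _ ⟩} (mk≈ᶠ e) = mk≈ᶠ (begin
    - a * d     ≈⟨ -‿distribˡ-* a d ⟨
    - (a * d)   ≈⟨ -‿cong e ⟩
    - (c * b)   ≈⟨ -‿distribˡ-* c b ⟩
    - c * b     ∎)

  +ᶠ-assoc : ∀ q r s → (q +ᶠ r) +ᶠ s ≈ᶠ q +ᶠ (r +ᶠ s)
  +ᶠ-assoc (a / b ⟨ _ ⟩) (c / d ⟨ _ ⟩) (e / f ⟨ _ ⟩) = mk≈ᶠ (solve 6 (λ a b c d e f →
    (((a :* d :+ c :* b) :* f :+ e :* (b :* d)) :* (b :* (d :* f))) :=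
    ((a :* (d :* f) :+ (c :* f :+ e :* d) :* b) :* ((b :* d) :* f))) refl a b c d e f)

  +ᶠ-comm : ∀ q r → q +ᶠ r ≈ᶠ r +ᶠ q
  +ᶠ-comm (a / b ⟨ _ ⟩) (c / d ⟨ _ ⟩) = mk≈ᶠ (solve 4 (λ a b c d →
    ((a :* d :+ c :* b) :* (d :* b)) := ((c :* b :+ a :* d) :* (b :* d))) refl a b c d)

  +ᶠ-identityˡ : ∀ q → embed 0# +ᶠ q ≈ᶠ q
  +ᶠ-identityˡ (a / b ⟨ _ ⟩) = mk≈ᶠ (begin
    (0# * b + a * 1#) * b   ≈⟨ *-congʳ (+-congʳ (zeroˡ b)) ⟩
    (0# + a * 1#) * b       ≈⟨ *-congʳ (+-identityˡ _) ⟩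
    (a * 1#) * b            ≈⟨ *-assoc a 1# b ⟩
    a * (1# * b)            ∎)

  +ᶠ-identityʳ : ∀ q → q +ᶠ embed 0# ≈ᶠ q
  +ᶠ-identityʳ q = ≈ᶠ-trans (+ᶠ-comm q (embed 0#)) (+ᶠ-identityˡ q)

  -ᶠ-inverseˡ : ∀ q → (-ᶠ q) +ᶠ q ≈ᶠ embed 0#
  -ᶠ-inverseˡ (a / b ⟨ _ ⟩) = mk≈ᶠ (begin
    (- a * b + a * b) * 1#   ≈⟨ *-identityʳ _ ⟩
    - a * b + a * b          ≈⟨ distribʳ b (- a) a ⟨
    (- a + a) * b            ≈⟨ *-congʳ (-‿inverseˡ a) ⟩
    0# * b                   ≈⟨ zeroˡ b ⟩
    0#                       ≈⟨ zeroˡ _ ⟨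
    0# * (b * b)             ∎)

  -ᶠ-inverseʳ : ∀ q → q +ᶠ (-ᶠ q) ≈ᶠ embed 0#
  -ᶠ-inverseʳ q = ≈ᶠ-trans (+ᶠ-comm q (-ᶠ q)) (-ᶠ-inverseˡ q)

  *ᶠ-assoc : ∀ q r s → (q *ᶠ r) *ᶠ s ≈ᶠ q *ᶠ (r *ᶠ s)
  *ᶠ-assoc (a / b ⟨ _ ⟩) (c / d ⟨ _ ⟩) (e / f ⟨ _ ⟩) =
    mk≈ᶠ (*-cong (*-assoc a c e) (sym (*-assoc b d f)))

  *ᶠ-comm : ∀ q r → q *ᶠ r ≈ᶠ r *ᶠ q
  *ᶠ-comm (a / b ⟨ _ ⟩) (c / d ⟨ _ ⟩) = mk≈ᶠ (*-cong (*-comm a c) (*-comm d b))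

  *ᶠ-identityˡ : ∀ q → embed 1# *ᶠ q ≈ᶠ q
  *ᶠ-identityˡ (a / b ⟨ _ ⟩) = mk≈ᶠ (*-cong (*-identityˡ a) (sym (*-identityˡ b)))

  *ᶠ-identityʳ : ∀ q → q *ᶠ embed 1# ≈ᶠ q
  *ᶠ-identityʳ q = ≈ᶠ-trans (*ᶠ-comm q (embed 1#)) (*ᶠ-identityˡ q)

  *ᶠ-distribˡ : ∀ q r s → q *ᶠ (r +ᶠ s) ≈ᶠ q *ᶠ r +ᶠ q *ᶠ s
  *ᶠ-distribˡ (a / b ⟨ _ ⟩) (c / d ⟨ _ ⟩) (e / f ⟨ _ ⟩) = mk≈ᶠ (solve 6 (λ a b c d e f →
    ((a :* (c :* f :+ e :* d)) :* ((b :* d) :* (b :* f))) :=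
    (((a :* c) :* (b :* f) :+ (a :* e) :* (b :* d)) :* (b :* (d :* f)))) refl a b c d e f)

  *ᶠ-distribʳ : ∀ q r s → (r +ᶠ s) *ᶠ q ≈ᶠ r *ᶠ q +ᶠ s *ᶠ q
  *ᶠ-distribʳ q r s = ≈ᶠ-trans (*ᶠ-comm (r +ᶠ s) q)
    (≈ᶠ-trans (*ᶠ-distribˡ q r s) (+ᶠ-cong (*ᶠ-comm q r) (*ᶠ-comm q s)))

  isCommutativeRingᶠ : IsCommutativeRing _≈ᶠ_ _+ᶠ_ _*ᶠ_ -ᶠ_ (embed 0#) (embed 1#)
  isCommutativeRingᶠ = record
    { isRing = record
      { +-isAbelianGroup = record
        { isGroup = record
          { isMonoid = record
            { isSemigroup = record
              { isMagma = record
                { isEquivalence = record { refl = ≈ᶠ-refl ; sym = ≈ᶠ-sym ; trans = ≈ᶠ-trans }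
                ; ∙-cong = +ᶠ-cong
                }
              ; assoc = +ᶠ-assoc
              }
            ; identity = +ᶠ-identityˡ , +ᶠ-identityʳ
            }
          ; inverse = -ᶠ-inverseˡ , -ᶠ-inverseʳ
          ; ⁻¹-cong = -ᶠ-cong
          }
        ; comm = +ᶠ-comm
        }
      ; *-cong     = *ᶠ-cong
      ; *-assoc    = *ᶠ-assoc
      ; *-identity = *ᶠ-identityˡ , *ᶠ-identityʳ
      ; distrib    = *ᶠ-distribˡ , *ᶠ-distribʳ
      }
    ; *-comm = *ᶠ-comm
    }

  fractionField : CommutativeRing 0ℓ 0ℓ
  fractionField = record { isCommutativeRing = isCommutativeRingᶠ }

module ℤ[u] = Polynomial ℤ-domain
module ℤ[u,x] = Polynomial ℤ[u].polynomialDomain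
module ℤ⟨u,x⟩ = FieldOfFractions ℤ[u,x].polynomialDomain

polynomialRing : CommutativeRing 0ℓ 0ℓ
polynomialRing = IntegralDomain.commutativeRing ℤ[u,x].polynomialDomain

rationalFunctions : CommutativeRing 0ℓ 0ℓ
rationalFunctions = ℤ⟨u,x⟩.fractionField

u x : CommutativeRing.Carrier polynomialRing
u = ℤ[u,x].constant ℤ[u].X
x = ℤ[u,x].X

module Polynomials       = Evaluation polynomialRing
module RationalFunctions = Evaluation rationalFunctions

-- The constant term of p(k, u, x) in x is 1.
p≉0 : ∀ k → ¬ (CommutativeRing._≈_ polynomialRing (Polynomials.p k u x) (CommutativeRing.0# polynomialRing))
p≉0 k p≈0 = IntegralDomain.1≉0 ℤ[u].polynomialDomain
  (trans (sym coeff₀-p) (coeff-≈ p≈0 0))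
  where
  open CommutativeRing (IntegralDomain.commutativeRing ℤ[u].polynomialDomain)
  open ℤ[u,x]
  open Polynomials using (_^_)
  open import Algebra.Properties.Ring ring using (-0#≈0#)
  open import Relation.Binary.Reasoning.Setoid setoid

  1+x : Poly
  1+x = constant 1# +ₚ x

  coeff₀-^ : ∀ k → coeff (1+x ^ k) 0 ≈ 1#
  coeff₀-^ zero    = refl
  coeff₀-^ (suc k) = begin
    coeff (1+x *ₚ (1+x ^ k)) 0            ≈⟨ coeff₀-* 1+x (1+x ^ k) ⟩
    coeff 1+x 0 * coeff (1+x ^ k) 0       ≈⟨ *-cong (+-identityʳ 1#) (coeff₀-^ k) ⟩
    1# * 1#                               ≈⟨ *-identityˡ 1# ⟩
    1#                                    ∎

  xu² : Poly
  xu² = x *ₚ (u ^ 2)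

  coeff₀-xu² : coeff xu² 0 ≈ 0#
  coeff₀-xu² = trans (coeff₀-* x (u ^ 2)) (zeroˡ (coeff (u ^ 2) 0))

  coeff₀-p : coeff (Polynomials.p k u x) 0 ≈ 1#
  coeff₀-p = begin
    coeff ((1+x ^ k) *ₚ (xu² +ₚ constant 1#) +ₚ (-ₚ xu²)) 0
      ≈⟨ coeff-+ ((1+x ^ k) *ₚ (xu² +ₚ constant 1#)) (-ₚ xu²) 0 ⟩
    coeff ((1+x ^ k) *ₚ (xu² +ₚ constant 1#)) 0 + coeff (-ₚ xu²) 0
      ≈⟨ +-cong (coeff₀-* (1+x ^ k) (xu² +ₚ constant 1#)) (coeff-neg xu² 0) ⟩
    coeff (1+x ^ k) 0 * coeff (xu² +ₚ constant 1#) 0 + - coeff xu² 0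
      ≈⟨ +-cong (*-cong (coeff₀-^ k) (coeff-+ xu² (constant 1#) 0)) (-‿cong coeff₀-xu²) ⟩
    1# * (coeff xu² 0 + 1#) + - 0#
      ≈⟨ +-cong (*-congˡ {1#} (+-congʳ {1#} coeff₀-xu²)) -0#≈0# ⟩
    1# * (0# + 1#) + 0#
      ≈⟨ +-identityʳ _ ⟩
    1# * (0# + 1#)
      ≈⟨ *-identityˡ _ ⟩
    0# + 1#
      ≈⟨ +-identityˡ 1# ⟩
    1# ∎

x/p : ℕ → CommutativeRing.Carrier rationalFunctions
x/p k = x ℤ⟨u,x⟩./ Polynomials.p k u x ⟨ p≉0 k ⟩

open CommutativeRing rationalFunctions using (_≈_; _*_) public
open RationalFunctions using (_^_) public
open ℤ⟨u,x⟩ using (embed) public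

{-# OPTIONS --safe #-}
module Submission where

-- Let C be the k-comb of G at a, A a set of old vertices and B a set of teeth.
-- Then rk C[A ∪ B] = rk G[A] if a ∉ A or B = ∅, and rk C[A ∪ B] = 2 + rk G[A ∖ a]
-- otherwise.  Both follow by comparing kernel sizes: over 𝔽₂ a matrix with m rows
-- and rank r has a left kernel with 2^(m - r) elements.
--
-- To treat the combs one at a time, let W(G, w) be the sum over A of
-- x^|A| ∏_{v ∉ A} w(v) u^rk G[A].  Summing over B, a comb at a only replaces w(a)
-- by w(a)(1 + x)^k + xu²((1 + x)^k - 1).  After one comb at every vertex, starting
-- from w = 1, all weights equal p(k, u, x), and W(G, p) = p^|V| P(G; u, x/p).

open import Defs hiding (u; x; _≈_; _*_; _^_; embed)
open import Level using (0ℓ)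
open import Algebra.Bundles using (CommutativeRing; CommutativeSemiring)
open import Data.Bool.Base using (Bool; true; false; not; _∧_; _∨_; _xor_; if_then_else_)
import Data.Bool.Properties as Boolₚ
open import Data.Fin.Base using (Fin; zero; suc; _↑ˡ_; _↑ʳ_; punchIn; splitAt; join)
import Data.Fin.Properties as Finₚ
open import Data.Fin.Subset using (Subset; inside; outside; ∣_∣)
open import Data.Fin.Subset.Properties using (anySubset?)
import Data.List.Base as List
import Data.List.Properties as Listₚ
import Data.List.Relation.Unary.All as All
import Data.List.Relation.Unary.All.Properties as Allₚ
open import Data.List.Membership.Propositional using (_∈_)
open import Data.List.Membership.Propositional.Properties
  using (∈-map⁺; ∈-++⁺ˡ; ∈-++⁺ʳ; ∈-filter⁺; ∈-filter⁻)
import Data.List.Relation.Unary.Any as Any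
open import Data.List.Extrema.Nat using (max≤v⁺; xs≤max)
open import Data.Nat.Base as ℕ using (ℕ; zero; suc; z≤n; NonZero; _≥_)
import Data.Nat.Properties as ℕₚ
open import Data.Product.Base using (∃; _×_; _,_; proj₁; proj₂)
open import Data.Sum.Base using ([_,_])
open import Data.Vec.Base as Vec using (Vec; []; _∷_; _++_; lookup; tabulate; zipWith; insertAt)
import Data.Vec.Properties as Vecₚ
open import Function.Base using (_∘_)
open import Function.Bundles using (_⇔_; mk⇔; Equivalence)
open import Relation.Binary.PropositionalEquality
  using (_≡_; _≢_; refl; sym; trans; cong; cong₂; subst; module ≡-Reasoning)
open import Relation.Nullary.Decidable using (Dec; yes; no; does; dec-true; dec-false; does-⇔; _→-dec_; _×-dec_)
open import Relation.Nullary.Negation using (¬_; contradiction)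

-- Combing a single vertex changes only the factor attached to that vertex, which the one variable
-- `x` of `P` cannot record. Hence the separate weights: they become uniform again only when every
-- vertex has been combed. The two extra ranks have a concrete source. When `a` and a tooth are both
-- selected, the column of the tooth forces the coefficient of `a` in a kernel vector to vanish, and
-- the column of `a` prescribes the parity of the coefficients of the selected teeth. Each condition
-- halves the kernel, measured against the kernel without `a` with all tooth coefficients free. The
-- vanishing coefficient also removes `a` from the remaining conditions, which is why the graph
-- without `a` appears. All cardinalities are compared after multiplying out powers of 2, so no
-- subtraction or division occurs in ℕ. On the polynomial side division is confined to one
-- hypothesis `y * p k u x ≈ x`, valid in any commutative ring and met by `x/p k` among the rational
-- functions.

-- Sums indexed by all subsets of a finite set.

module SubsetSums (S : CommutativeSemiring 0ℓ 0ℓ) where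
  open CommutativeSemiring S hiding (refl; sym; trans)
  open CommutativeSemiring S using () renaming (refl to ≈-refl; sym to ≈-sym; trans to ≈-trans)
  open import Algebra.Properties.CommutativeSemigroup +-commutativeSemigroup using (interchange)

  -- Recursion on `n` replaces the fold over `subsets n` so that sum identities follow by induction;
  -- `Σ⊆-foldr` returns to the form used in `P`.
  Σ⊆ : ∀ n → (Subset n → Carrier) → Carrier
  Σ⊆ zero    f = f []
  Σ⊆ (suc n) f = Σ⊆ n (f ∘ (outside ∷_)) + Σ⊆ n (f ∘ (inside ∷_))

  Σ⊆-cong : ∀ n {f g} → (∀ A → f A ≈ g A) → Σ⊆ n f ≈ Σ⊆ n g
  Σ⊆-cong zero    e = e []
  Σ⊆-cong (suc n) e = +-cong (Σ⊆-cong n (e ∘ (outside ∷_))) (Σ⊆-cong n (e ∘ (inside ∷_)))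

  Σ⊆-+ : ∀ n f g → Σ⊆ n (λ A → f A + g A) ≈ Σ⊆ n f + Σ⊆ n g
  Σ⊆-+ zero    f g = ≈-refl
  Σ⊆-+ (suc n) f g = ≈-trans
    (+-cong (Σ⊆-+ n (f ∘ (outside ∷_)) (g ∘ (outside ∷_))) (Σ⊆-+ n (f ∘ (inside ∷_)) (g ∘ (inside ∷_))))
    (interchange _ _ _ _)

  Σ⊆-*ˡ : ∀ n c f → Σ⊆ n (λ A → c * f A) ≈ c * Σ⊆ n f
  Σ⊆-*ˡ zero    c f = ≈-refl
  Σ⊆-*ˡ (suc n) c f = ≈-trans (+-cong (Σ⊆-*ˡ n c _) (Σ⊆-*ˡ n c _)) (≈-sym (distribˡ c _ _))

  Σ⊆-*ʳ : ∀ n c f → Σ⊆ n (λ A → f A * c) ≈ Σ⊆ n f * c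
  Σ⊆-*ʳ n c f =
    ≈-trans (Σ⊆-cong n λ A → *-comm (f A) c) (≈-trans (Σ⊆-*ˡ n c f) (*-comm c _))

  Σ⊆-++ : ∀ m n f → Σ⊆ (m ℕ.+ n) f ≈ Σ⊆ m (λ A → Σ⊆ n (λ B → f (A ++ B)))
  Σ⊆-++ zero    n f = ≈-refl
  Σ⊆-++ (suc m) n f = +-cong (Σ⊆-++ m n _) (Σ⊆-++ m n _)

  -- This conditions a sum on one chosen coordinate, both for vertex sets (is `a` selected?) and for
  -- kernel vectors (is their entry at `a` zero?).
  Σ⊆-insertAt : ∀ n (i : Fin (suc n)) f →
    Σ⊆ (suc n) f ≈ Σ⊆ n (λ A → f (insertAt A i outside) + f (insertAt A i inside))
  Σ⊆-insertAt n       zero    f = ≈-sym (Σ⊆-+ n _ _)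
  Σ⊆-insertAt (suc n) (suc i) f = +-cong (Σ⊆-insertAt n i (f ∘ (outside ∷_))) (Σ⊆-insertAt n i (f ∘ (inside ∷_)))

  -- Adding `d` permutes the vectors: each `true` entry of `d` exchanges the two halves of the sum.
  Σ⊆-translate : ∀ {n} (d : Subset n) f → Σ⊆ n (λ c → f (zipWith _xor_ c d)) ≈ Σ⊆ n f
  Σ⊆-translate []          f = ≈-refl
  Σ⊆-translate (false ∷ d) f = +-cong (Σ⊆-translate d _) (Σ⊆-translate d _)
  Σ⊆-translate (true  ∷ d) f = ≈-trans (+-cong (Σ⊆-translate d _) (Σ⊆-translate d _)) (+-comm _ _)

  Σ⊆-foldr : ∀ n f → List.foldr _+_ 0# (List.map f (subsets n)) ≈ Σ⊆ n f
  Σ⊆-foldr zero    f = +-identityʳ _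
  Σ⊆-foldr (suc n) f
    rewrite Listₚ.map-++ f (List.map (outside ∷_) (subsets n)) (List.map (inside ∷_) (subsets n))
          | sym (Listₚ.map-∘ {g = f} {f = outside ∷_} (subsets n))
          | sym (Listₚ.map-∘ {g = f} {f = inside ∷_} (subsets n))
    = ≈-trans (sum-++ (List.map (f ∘ (outside ∷_)) (subsets n)) _)
              (+-cong (Σ⊆-foldr n _) (Σ⊆-foldr n _))
    where
    sum-++ : ∀ xs ys → List.foldr _+_ 0# (xs List.++ ys) ≈ List.foldr _+_ 0# xs + List.foldr _+_ 0# ys
    sum-++ List.[]       ys = ≈-sym (+-identityˡ _)
    sum-++ (x List.∷ xs) ys = ≈-trans (+-congˡ (sum-++ xs ys)) (≈-sym (+-assoc _ _ _))

-- Cardinalities of sets of vectors over 𝔽₂.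

module Counting where
  open import Data.Nat.Base using (_+_; _*_; _^_; _≤_)
  open SubsetSums ℕₚ.+-*-commutativeSemiring public

  indicator : Bool → ℕ
  indicator b = if b then 1 else 0

  count : ∀ n → (Subset n → Bool) → ℕ
  count n K = Σ⊆ n (indicator ∘ K)

  count-cong : ∀ n {K L : Subset n → Bool} → (∀ c → K c ≡ L c) → count n K ≡ count n L
  count-cong n e = Σ⊆-cong n (cong indicator ∘ e)

  Σ⊆-const : ∀ n t → Σ⊆ n (λ _ → t) ≡ t * 2 ^ n
  Σ⊆-const zero    t = sym (ℕₚ.*-identityʳ t)
  Σ⊆-const (suc n) t rewrite Σ⊆-const n t = double t (2 ^ n)
    where
    open import Data.Nat.Solver using (module +-*-Solver)
    open +-*-Solver
    double : ∀ t s → t * s + t * s ≡ t * (2 * s)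
    double = solve 2 (λ t s → t :* s :+ t :* s := t :* (con 2 :* s)) refl

  count-positive : ∀ n (K : Subset n → Bool) c → K c ≡ true → 0 ℕ.< count n K
  count-positive zero    K []          e rewrite e = ℕ.s≤s z≤n
  count-positive (suc n) K (false ∷ c) e = ℕₚ.<-≤-trans (count-positive n _ c e) (ℕₚ.m≤m+n _ _)
  count-positive (suc n) K (true  ∷ c) e = ℕₚ.<-≤-trans (count-positive n _ c e) (ℕₚ.m≤n+m _ _)

  -- Members of `K` are determined by their coordinates outside `S`, and these take at most 2^(m -
  -- |S|) values; the bound is multiplied out. At a coordinate in `S` the two slices are disjoint
  -- and their union again satisfies the hypothesis, so the induction continues with the union.
  count-injective : ∀ {m} (S : Subset m) (K : Subset m → Bool) →
    (∀ c d → K c ≡ true → K d ≡ true → (∀ i → lookup S i ≡ outside → lookup c i ≡ lookup d i) → c ≡ d) →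
    count m K * 2 ^ ∣ S ∣ ≤ 2 ^ m
  count-injective [] K inj with K []
  ... | true  = ℕₚ.≤-refl
  ... | false = z≤n
  count-injective {suc m} (outside ∷ S) K inj = begin
    (count m (K ∘ (false ∷_)) + count m (K ∘ (true ∷_))) * 2 ^ ∣ S ∣
      ≡⟨ ℕₚ.*-distribʳ-+ (2 ^ ∣ S ∣) (count m (K ∘ (false ∷_))) _ ⟩
    count m (K ∘ (false ∷_)) * 2 ^ ∣ S ∣ + count m (K ∘ (true ∷_)) * 2 ^ ∣ S ∣
      ≤⟨ ℕₚ.+-mono-≤ (slice false) (slice true) ⟩
    2 ^ m + 2 ^ m
      ≡⟨ cong (2 ^ m +_) (ℕₚ.+-identityʳ (2 ^ m)) ⟨
    2 ^ suc m ∎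
    where
    open ℕₚ.≤-Reasoning
    slice : ∀ b → count m (K ∘ (b ∷_)) * 2 ^ ∣ S ∣ ≤ 2 ^ m
    slice b = count-injective S (K ∘ (b ∷_)) λ c d Kc Kd agree →
      Vecₚ.∷-injectiveʳ (inj (b ∷ c) (b ∷ d) Kc Kd λ { zero _ → refl ; (suc i) → agree i })
  count-injective {suc m} (inside ∷ S) K inj = begin
    (count m K₀ + count m K₁) * (2 * 2 ^ ∣ S ∣)  ≡⟨ cong (_* (2 * 2 ^ ∣ S ∣)) merge ⟩
    count m K₀₁ * (2 * 2 ^ ∣ S ∣)                ≡⟨ ℕₚ.*-comm (count m K₀₁) _ ⟩
    2 * 2 ^ ∣ S ∣ * count m K₀₁                  ≡⟨ ℕₚ.*-assoc 2 (2 ^ ∣ S ∣) _ ⟩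
    2 * (2 ^ ∣ S ∣ * count m K₀₁)                ≡⟨ cong (2 *_) (ℕₚ.*-comm (2 ^ ∣ S ∣) _) ⟩
    2 * (count m K₀₁ * 2 ^ ∣ S ∣)                ≤⟨ ℕₚ.*-monoʳ-≤ 2 (count-injective S K₀₁ inj₀₁) ⟩
    2 * 2 ^ m                                    ∎
    where
    open ℕₚ.≤-Reasoning
    K₀ K₁ K₀₁ : Subset m → Bool
    K₀ = K ∘ (false ∷_)
    K₁ = K ∘ (true ∷_)
    K₀₁ c = K₀ c ∨ K₁ c

    inj-∷ : ∀ a b c d → K (a ∷ c) ≡ true → K (b ∷ d) ≡ true →
            (∀ i → lookup S i ≡ outside → lookup c i ≡ lookup d i) → a ∷ c ≡ b ∷ d
    inj-∷ a b c d Kc Kd agree = inj (a ∷ c) (b ∷ d) Kc Kd λ { (suc i) → agree i }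

    -- A vector in both slices would give two members of `K` that differ only at a coordinate in
    -- `S`.
    disjoint : ∀ c → indicator (K₀ c) + indicator (K₁ c) ≡ indicator (K₀₁ c)
    disjoint c with K₀ c in e₀ | K₁ c in e₁
    ... | false | _     = refl
    ... | true  | false = refl
    ... | true  | true  with () ← inj-∷ false true c c e₀ e₁ (λ _ _ → refl)

    merge : count m K₀ + count m K₁ ≡ count m K₀₁
    merge = trans (sym (Σ⊆-+ m _ _)) (Σ⊆-cong m disjoint)

    witness : ∀ c → K₀₁ c ≡ true → ∃ λ b → K (b ∷ c) ≡ true
    witness c e with K₀ c in e₀
    ... | true  = false , e₀
    ... | false = true , e

    inj₀₁ : ∀ c d → K₀₁ c ≡ true → K₀₁ d ≡ true →
            (∀ i → lookup S i ≡ outside → lookup c i ≡ lookup d i) → c ≡ d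
    inj₀₁ c d Kc Kd agree with a , Kac ← witness c Kc | b , Kbd ← witness d Kd =
      Vecₚ.∷-injectiveʳ (inj-∷ a b c d Kac Kbd agree)

  restrict : ∀ {n} (S : Subset n) → Subset n → Subset ∣ S ∣
  restrict S c = tabulate (lookup c ∘ elements S)

  -- Every vector indexed by `S` has 2^(n - |S|) extensions to all `n` coordinates, since the
  -- coordinates outside `S` are free.
  count-restrict : ∀ {n} (S : Subset n) (K : Subset ∣ S ∣ → Bool) →
    count n (K ∘ restrict S) * 2 ^ ∣ S ∣ ≡ count ∣ S ∣ K * 2 ^ n
  count-restrict []            K = refl
  count-restrict {suc n} (outside ∷ S) K = begin
    (c + c) * 2 ^ ∣ S ∣               ≡⟨ ℕₚ.*-distribʳ-+ (2 ^ ∣ S ∣) c c ⟩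
    c * 2 ^ ∣ S ∣ + c * 2 ^ ∣ S ∣     ≡⟨ cong₂ _+_ (count-restrict S K) (count-restrict S K) ⟩
    k * 2 ^ n + k * 2 ^ n             ≡⟨ ℕₚ.*-distribˡ-+ k (2 ^ n) _ ⟨
    k * (2 ^ n + 2 ^ n)               ≡⟨ cong (λ t → k * (2 ^ n + t)) (ℕₚ.+-identityʳ (2 ^ n)) ⟨
    k * 2 ^ suc n                     ∎
    where
    open ≡-Reasoning
    c = count n (K ∘ restrict S)
    k = count ∣ S ∣ K
  count-restrict {suc n} (inside ∷ S) K =
    combine (count n (K₀ ∘ restrict S)) (count n (K₁ ∘ restrict S)) (count ∣ S ∣ K₀) (count ∣ S ∣ K₁)
            (2 ^ ∣ S ∣) (2 ^ n) (count-restrict S K₀) (count-restrict S K₁)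
    where
    K₀ K₁ : Subset ∣ S ∣ → Bool
    K₀ = K ∘ (false ∷_)
    K₁ = K ∘ (true ∷_)
    combine : ∀ a b c d s t → a * s ≡ c * t → b * s ≡ d * t → (a + b) * (2 * s) ≡ (c + d) * (2 * t)
    combine a b c d s t e f = begin
      (a + b) * (2 * s)     ≡⟨ regroup a b s ⟩
      2 * (a * s + b * s)   ≡⟨ cong (2 *_) (cong₂ _+_ e f) ⟩
      2 * (c * t + d * t)   ≡⟨ regroup c d t ⟨
      (c + d) * (2 * t)     ∎
      where
      open ≡-Reasoning
      open import Data.Nat.Solver using (module +-*-Solver)
      open +-*-Solver
      regroup : ∀ a b s → (a + b) * (2 * s) ≡ 2 * (a * s + b * s)
      regroup = solve 3 (λ a b s → (a :+ b) :* (con 2 :* s) := con 2 :* (a :* s :+ b :* s)) refl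

-- Finite sums in 𝔽₂.

module 𝔽₂-Sums where
  open CommutativeRing Boolₚ.xor-∧-commutativeRing using (+-commutativeMonoid; semiring)
  open import Algebra.Properties.CommutativeMonoid.Sum +-commutativeMonoid public
    using (∑-distrib-+; sum-cong-≗; sum-replicate-zero)
  open import Algebra.Properties.Semiring.Sum semiring public using (*-distribʳ-sum)

  sum-++ : ∀ m n (f : Fin (m ℕ.+ n) → Bool) →
    sum𝔽₂ f ≡ sum𝔽₂ (λ i → f (i ↑ˡ n)) xor sum𝔽₂ (λ j → f (m ↑ʳ j))
  sum-++ zero    n f = refl
  sum-++ (suc m) n f = trans (cong (f zero xor_) (sum-++ m n (f ∘ suc))) (sym (Boolₚ.xor-assoc (f zero) _ _))

  sum-elements : ∀ {n} (S : Subset n) (f : Fin n → Bool) →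
    sum𝔽₂ (f ∘ elements S) ≡ sum𝔽₂ (λ i → lookup S i ∧ f i)
  sum-elements []            f = refl
  sum-elements (inside  ∷ S) f = cong (f zero xor_) (sum-elements S (f ∘ suc))
  sum-elements (outside ∷ S) f = sum-elements S (f ∘ suc)

  sum-zipWith-xor : ∀ {n} (c d : Subset n) (f : Fin n → Bool) →
    sum𝔽₂ (λ i → lookup (zipWith _xor_ c d) i ∧ f i)
    ≡ sum𝔽₂ (λ i → lookup c i ∧ f i) xor sum𝔽₂ (λ i → lookup d i ∧ f i)
  sum-zipWith-xor c d f = trans
    (sum-cong-≗ λ i → trans (cong (_∧ f i) (Vecₚ.lookup-zipWith _xor_ i c d))
                            (Boolₚ.∧-distribʳ-xor (f i) (lookup c i) (lookup d i)))
    (∑-distrib-+ (λ i → lookup c i ∧ f i) (λ i → lookup d i ∧ f i))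

  sum-point : ∀ {n} (a : Fin n) (f : Fin n → Bool) → sum𝔽₂ (λ i → f i ∧ does (i Finₚ.≟ a)) ≡ f a
  sum-point {suc n} zero    f = begin
    f zero ∧ true xor sum𝔽₂ (λ i → f (suc i) ∧ false)
      ≡⟨ cong₂ _xor_ (Boolₚ.∧-identityʳ (f zero))
               (trans (sum-cong-≗ λ i → Boolₚ.∧-zeroʳ (f (suc i))) (sum-replicate-zero n)) ⟩
    f zero xor false
      ≡⟨ Boolₚ.xor-identityʳ (f zero) ⟩
    f zero ∎
    where open ≡-Reasoning
  sum-point (suc a) f rewrite Boolₚ.∧-zeroʳ (f zero) = sum-point a (f ∘ suc)

  xor≡false : ∀ {a b} → a xor b ≡ false → a ≡ b
  xor≡false {false} {false} _ = refl
  xor≡false {true}  {true}  _ = refl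

-- Left kernels and the rank-nullity theorem over 𝔽₂.

module RankNullity where
  open import Data.Nat.Base using (_+_; _*_; _^_; _≤_)
  open Counting
  open 𝔽₂-Sums

  lookup-elements : ∀ {n} (S : Subset n) i → lookup S (elements S i) ≡ inside
  lookup-elements (inside  ∷ S) zero    = refl
  lookup-elements (inside  ∷ S) (suc i) = lookup-elements S i
  lookup-elements (outside ∷ S) i       = lookup-elements S i

  elements-surjective : ∀ {n} (S : Subset n) j → lookup S j ≡ inside → ∃ λ i → elements S i ≡ j
  elements-surjective (inside  ∷ S) zero    e = zero , refl
  elements-surjective (inside  ∷ S) (suc j) e with i , refl ← elements-surjective S j e = suc i , refl
  elements-surjective (outside ∷ S) (suc j) e with i , refl ← elements-surjective S j e = i , refl

  extend : ∀ {n} (S : Subset n) → Subset ∣ S ∣ → Subset n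
  extend []            c       = []
  extend (inside  ∷ S) (b ∷ c) = b ∷ extend S c
  extend (outside ∷ S) c       = false ∷ extend S c

  sum-extend : ∀ {n} (S : Subset n) c (f : Fin n → Bool) →
    sum𝔽₂ (λ i → lookup (extend S c) i ∧ f i) ≡ sum𝔽₂ (λ i → lookup c i ∧ f (elements S i))
  sum-extend []            c       f = refl
  sum-extend (inside  ∷ S) (b ∷ c) f = cong (b ∧ f zero xor_) (sum-extend S c (f ∘ suc))
  sum-extend (outside ∷ S) c       f = sum-extend S c (f ∘ suc)

  vanishing? : ∀ {m n} (M : Matrix m n) c → Dec (VanishingCombination M c)
  vanishing? M c = Finₚ.all? λ j → sum𝔽₂ (λ i → lookup c i ∧ M i j) Boolₚ.≟ false

  nullity-count : ∀ {m n} → Matrix m n → ℕ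
  nullity-count {m} M = count m (does ∘ vanishing? M)

  true⇒holds : ∀ {P : Set} (P? : Dec P) → does P? ≡ true → P
  true⇒holds (yes p) _ = p

  nullity-count-positive : ∀ {m n} (M : Matrix m n) → 0 ℕ.< nullity-count M
  nullity-count-positive {m} M = 
    count-positive m _ (Vec.replicate m false) (dec-true (vanishing? M (Vec.replicate m false)) zero-vanishes)
    where
    zero-vanishes : VanishingCombination M (Vec.replicate m false)
    zero-vanishes j = trans
      (sum-cong-≗ λ i → cong (_∧ M i j) (Vecₚ.lookup-replicate i false)) (sum-replicate-zero m)

  -- If two kernel vectors agree outside `S`, their difference is a relation among the rows in `S`,
  -- hence zero. So the kernel is determined by the coordinates outside `S`.
  independent⇒nullity-count-≤ : ∀ {m n} (M : Matrix m n) (S : Subset m) →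
    LinearlyIndependent (M ∘ elements S) → nullity-count M * 2 ^ ∣ S ∣ ≤ 2 ^ m
  independent⇒nullity-count-≤ M S independent = count-injective S _ injective
    where
    injective : ∀ c d → does (vanishing? M c) ≡ true → does (vanishing? M d) ≡ true →
      (∀ i → lookup S i ≡ outside → lookup c i ≡ lookup d i) → c ≡ d
    injective c d Kc Kd agree =
      trans (sym (Vecₚ.tabulate∘lookup c)) (trans (Vecₚ.tabulate-cong pointwise) (Vecₚ.tabulate∘lookup d))
      where
      e = zipWith _xor_ c d

      -- `e` vanishes off `S` because `c` and `d` agree there, so the sum may be confined to the
      -- rows in `S`.
      e-outside : ∀ i (f : Bool) → lookup S i ∧ (lookup e i ∧ f) ≡ lookup e i ∧ f
      e-outside i f with lookup S i in Sᵢ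
      ... | true = refl
      ... | false rewrite Vecₚ.lookup-zipWith _xor_ i c d | agree i Sᵢ | Boolₚ.xor-same (lookup d i) = refl

      e-vanishes : VanishingCombination (M ∘ elements S) (restrict S e)
      e-vanishes j = begin
        sum𝔽₂ (λ i → lookup (restrict S e) i ∧ M (elements S i) j)
          ≡⟨ sum-cong-≗ (λ i → cong (_∧ M (elements S i) j) (Vecₚ.lookup∘tabulate _ i)) ⟩
        sum𝔽₂ (λ i → lookup e (elements S i) ∧ M (elements S i) j)
          ≡⟨ sum-elements S (λ i → lookup e i ∧ M i j) ⟩
        sum𝔽₂ (λ i → lookup S i ∧ (lookup e i ∧ M i j))
          ≡⟨ sum-cong-≗ (λ i → e-outside i (M i j)) ⟩
        sum𝔽₂ (λ i → lookup e i ∧ M i j)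
          ≡⟨ sum-zipWith-xor c d (λ i → M i j) ⟩
        sum𝔽₂ (λ i → lookup c i ∧ M i j) xor sum𝔽₂ (λ i → lookup d i ∧ M i j)
          ≡⟨ cong₂ _xor_ (true⇒holds (vanishing? M c) Kc j) (true⇒holds (vanishing? M d) Kd j) ⟩
        false ∎
        where open ≡-Reasoning

      pointwise : ∀ i → lookup c i ≡ lookup d i
      pointwise i with lookup S i in Sᵢ
      ... | false = agree i Sᵢ
      ... | true with i′ , refl ← elements-surjective S i Sᵢ = xor≡false (begin
        lookup c i xor lookup d i   ≡⟨ Vecₚ.lookup-zipWith _xor_ i c d ⟨
        lookup e i                  ≡⟨ Vecₚ.lookup∘tabulate _ i′ ⟨
        lookup (restrict S e) i′    ≡⟨ independent (restrict S e) e-vanishes i′ ⟩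
        false                       ∎)
        where open ≡-Reasoning

  -- Maximality is expressed through `size`: it turns the bound of `independent⇒nullity-count-≤`
  -- into an equality, so no independent set of rows can be larger.
  record RowBasis {m n} (M : Matrix m n) : Set where
    field
      rows        : Subset m
      independent : LinearlyIndependent (M ∘ elements rows)
      size        : nullity-count M * 2 ^ ∣ rows ∣ ≡ 2 ^ m

  -- Induction on the rows. If the first row is a combination of the others, the kernel doubles and
  -- the basis stays. Otherwise every kernel vector has first entry zero, so the kernel keeps its
  -- size and the basis gains a row.
  rowBasis : ∀ {m n} (M : Matrix m n) → RowBasis M
  rowBasis {zero} M = record { rows = [] ; independent = λ _ _ () ; size = size₀ }
    where
    size₀ : indicator (does (vanishing? M [])) * 1 ≡ 1
    size₀ rewrite dec-true (vanishing? M []) (λ _ → refl) = refl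
  rowBasis {suc m} M = extendBasis (anySubset? λ d → Finₚ.all? λ j → combination d j Boolₚ.≟ M zero j)
    where
    M′ = M ∘ suc
    open RowBasis (rowBasis M′)
    combination : Subset m → _ → Bool
    combination d j = sum𝔽₂ (λ i → lookup d i ∧ M′ i j)

    extendBasis : Dec (∃ λ d → ∀ j → combination d j ≡ M zero j) → RowBasis M
    extendBasis (yes (d , d-spans)) = record
      { rows = outside ∷ rows ; independent = independent ; size = size′ }
      where
      -- Replacing the first row by the combination `d` identifies the kernel vectors starting with
      -- `true` with a translate of the smaller kernel, which therefore is counted a second time.
      shift : ∀ c → does (vanishing? M (true ∷ c)) ≡ does (vanishing? M′ (zipWith _xor_ c d))
      shift c = does-⇔ (mk⇔ (λ v j → trans (sum-⊕ j) (v j)) (λ v j → trans (sym (sum-⊕ j)) (v j)))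
        (vanishing? M (true ∷ c)) (vanishing? M′ (zipWith _xor_ c d))
        where
        sum-⊕ : ∀ j → combination (zipWith _xor_ c d) j ≡ M zero j xor combination c j
        sum-⊕ j = trans (sum-zipWith-xor c d (λ i → M′ i j))
          (trans (Boolₚ.xor-comm (combination c j) _) (cong (_xor combination c j) (d-spans j)))

      size′ : nullity-count M * 2 ^ ∣ rows ∣ ≡ 2 ^ suc m
      size′ = begin
        (nullity-count M′ + count m (λ c → does (vanishing? M (true ∷ c)))) * 2 ^ ∣ rows ∣
          ≡⟨ cong (λ t → (nullity-count M′ + t) * 2 ^ ∣ rows ∣)
                  (trans (count-cong m shift) (Σ⊆-translate d (indicator ∘ does ∘ vanishing? M′))) ⟩
        (nullity-count M′ + nullity-count M′) * 2 ^ ∣ rows ∣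
          ≡⟨ ℕₚ.*-distribʳ-+ (2 ^ ∣ rows ∣) (nullity-count M′) _ ⟩
        nullity-count M′ * 2 ^ ∣ rows ∣ + nullity-count M′ * 2 ^ ∣ rows ∣
          ≡⟨ cong₂ _+_ size (trans size (sym (ℕₚ.+-identityʳ _))) ⟩
        2 ^ suc m ∎
        where open ≡-Reasoning
    extendBasis (no ¬spanned) = record
      { rows = inside ∷ rows ; independent = independent′ ; size = size′ }
      where
      independent′ : LinearlyIndependent (M ∘ elements (inside ∷ rows))
      independent′ (false ∷ c) v zero    = refl
      independent′ (false ∷ c) v (suc i) = independent c v i
      -- A relation that involves the first row would write it as a combination of the other rows.
      independent′ (true  ∷ c) v i = contradiction
        (extend rows c , λ j → trans (sum-extend rows c (λ i → M′ i j)) (sym (xor≡false (v j))))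
        ¬spanned

      none : ∀ c → does (vanishing? M (true ∷ c)) ≡ false
      none c = dec-false (vanishing? M (true ∷ c)) λ v → ¬spanned (c , λ j → sym (xor≡false (v j)))

      size′ : nullity-count M * (2 * 2 ^ ∣ rows ∣) ≡ 2 * 2 ^ m
      size′ = begin
        (nullity-count M′ + count m (λ c → does (vanishing? M (true ∷ c)))) * (2 * 2 ^ ∣ rows ∣)
          ≡⟨ cong (λ t → (nullity-count M′ + t) * (2 * 2 ^ ∣ rows ∣))
                  (trans (count-cong m none) (Σ⊆-const m 0)) ⟩
        (nullity-count M′ + 0) * (2 * 2 ^ ∣ rows ∣)
          ≡⟨ cong (_* (2 * 2 ^ ∣ rows ∣)) (ℕₚ.+-identityʳ (nullity-count M′)) ⟩
        nullity-count M′ * (2 * 2 ^ ∣ rows ∣)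
          ≡⟨ x∙yz≈y∙xz (nullity-count M′) 2 _ ⟩
        2 * (nullity-count M′ * 2 ^ ∣ rows ∣)
          ≡⟨ cong (2 *_) size ⟩
        2 * 2 ^ m ∎
        where
        open ≡-Reasoning
        open import Algebra.Properties.CommutativeSemigroup ℕₚ.*-commutativeSemigroup using (x∙yz≈y∙xz)

  ∈-subsets : ∀ {n} (S : Subset n) → S ∈ subsets n
  ∈-subsets []            = Any.here refl
  ∈-subsets (outside ∷ S) = ∈-++⁺ˡ (∈-map⁺ (outside ∷_) (∈-subsets S))
  ∈-subsets (inside  ∷ S) = ∈-++⁺ʳ _ (∈-map⁺ (inside ∷_) (∈-subsets S))

  2^-cancel-≤ : ∀ {a b} → 2 ^ a ≤ 2 ^ b → a ≤ b
  2^-cancel-≤ {a} {b} le = ℕₚ.≮⇒≥ λ b<a → ℕₚ.<⇒≱ (ℕₚ.^-monoʳ-< 2 ℕₚ.≤-refl b<a) le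

  -- `rank` is a maximum over a filtered list, so the exponent in `size` is matched with it by two
  -- inequalities: `rows` itself occurs in the list, and the kernel bound caps every member.
  rank-nullity : ∀ {m n} (M : Matrix m n) → nullity-count M * 2 ^ rank M ≡ 2 ^ m
  rank-nullity {m} M = subst (λ r → nullity-count M * 2 ^ r ≡ 2 ^ m) (ℕₚ.≤-antisym lower upper) size
    where
    open RowBasis (rowBasis M)
    independent-rows? : ∀ S → Dec (LinearlyIndependent (M ∘ elements S))
    independent-rows? S = linearlyIndependent? (M ∘ elements S)
    independentSets = List.filter independent-rows? (subsets m)

    lower : ∣ rows ∣ ≤ rank M
    lower = All.lookup (xs≤max 0 (List.map ∣_∣ independentSets))
      (∈-map⁺ ∣_∣ (∈-filter⁺ independent-rows? (∈-subsets rows) independent))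

    bound : ∀ {S} → S ∈ independentSets → ∣ S ∣ ≤ ∣ rows ∣
    -- The kernel size can be cancelled because the zero vector makes it positive.
    bound {S} S∈ = 2^-cancel-≤ (ℕₚ.*-cancelˡ-≤ (nullity-count M) {{ℕ.>-nonZero (nullity-count-positive M)}}
      (ℕₚ.≤-trans
        (independent⇒nullity-count-≤ M S (proj₂ (∈-filter⁻ independent-rows? {xs = subsets m} S∈)))
        (ℕₚ.≤-reflexive (sym size))))

    upper : rank M ≤ ∣ rows ∣
    upper = max≤v⁺ z≤n (Allₚ.map⁺ (All.tabulate bound))

-- Ranks of induced subgraphs of a comb.

module CombRanks where
  open import Data.Nat.Base using (_+_; _*_; _^_)
  open Counting
  open 𝔽₂-Sums
  open RankNullity

  -- Masking c by A, rather than reindexing by Fin ∣ A ∣, keeps the kernels of all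
  -- the induced subgraphs inside the same space 𝔽₂ⁿ.
  column : ∀ {n} → Graph n → Subset n → Subset n → Fin n → Bool
  column G A c j = sum𝔽₂ (λ i → (lookup A i ∧ lookup c i) ∧ adj G i j)

  Annihilates : ∀ {n} → Graph n → Subset n → Subset n → Set
  Annihilates G A c = ∀ j → lookup A j ≡ inside → column G A c j ≡ false

  annihilates? : ∀ {n} (G : Graph n) A c → Dec (Annihilates G A c)
  annihilates? G A c = Finₚ.all? λ j → (lookup A j Boolₚ.≟ inside) →-dec (column G A c j Boolₚ.≟ false)

  annihilatorCount : ∀ {n} → Graph n → Subset n → ℕ
  annihilatorCount {n} G A = count n (does ∘ annihilates? G A)

  annihilates⇔vanishing : ∀ {n} (G : Graph n) A c →
    Annihilates G A c ⇔ VanishingCombination (adj (G [ A ])) (restrict A c)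
  annihilates⇔vanishing G A c = mk⇔
    (λ ann j → trans (column-elements j) (ann (elements A j) (lookup-elements A j)))
    (λ van j j∈A → from-elements van (elements-surjective A j j∈A))
    where
    column-elements : ∀ j →
      sum𝔽₂ (λ i → lookup (restrict A c) i ∧ adj (G [ A ]) i j) ≡ column G A c (elements A j)
    column-elements j = begin
      sum𝔽₂ (λ i → lookup (restrict A c) i ∧ adj (G [ A ]) i j)
        ≡⟨ sum-cong-≗ (λ i → cong (_∧ adj (G [ A ]) i j) (Vecₚ.lookup∘tabulate (lookup c ∘ elements A) i)) ⟩
      sum𝔽₂ (λ i → lookup c (elements A i) ∧ adj G (elements A i) (elements A j))
        ≡⟨ sum-elements A (λ i → lookup c i ∧ adj G i (elements A j)) ⟩
      sum𝔽₂ (λ i → lookup A i ∧ (lookup c i ∧ adj G i (elements A j)))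
        ≡⟨ sum-cong-≗ (λ i → Boolₚ.∧-assoc (lookup A i) (lookup c i) _) ⟨
      column G A c (elements A j) ∎
      where open ≡-Reasoning

    from-elements : VanishingCombination (adj (G [ A ])) (restrict A c) →
      ∀ {j} → (∃ λ i → elements A i ≡ j) → column G A c j ≡ false
    from-elements van (i , refl) = trans (sym (column-elements i)) (van i)

  -- The coordinates outside `A` are unconstrained and contribute 2^(n - |A|). This turns the
  -- exponent |A| of rank-nullity for `G [ A ]` into `n`, the same for every `A`.
  annihilatorCount-rk : ∀ {n} (G : Graph n) A → annihilatorCount G A * 2 ^ rk (G [ A ]) ≡ 2 ^ n
  annihilatorCount-rk {n} G A =
    ℕₚ.*-cancelʳ-≡ _ _ (2 ^ ∣ A ∣) {{ℕₚ.m^n≢0 2 ∣ A ∣}} (begin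
      N * 2 ^ r * 2 ^ ∣ A ∣     ≡⟨ xy∙z≈xz∙y N (2 ^ r) _ ⟩
      N * 2 ^ ∣ A ∣ * 2 ^ r     ≡⟨ cong (_* 2 ^ r) N-restrict ⟩
      N′ * 2 ^ n * 2 ^ r        ≡⟨ xy∙z≈xz∙y N′ (2 ^ n) _ ⟩
      N′ * 2 ^ r * 2 ^ n        ≡⟨ cong (_* 2 ^ n) (rank-nullity (adj (G [ A ]))) ⟩
      2 ^ ∣ A ∣ * 2 ^ n         ≡⟨ ℕₚ.*-comm (2 ^ ∣ A ∣) _ ⟩
      2 ^ n * 2 ^ ∣ A ∣         ∎)
    where
    open ≡-Reasoning
    open import Algebra.Properties.CommutativeSemigroup ℕₚ.*-commutativeSemigroup using (xy∙z≈xz∙y)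
    r  = rk (G [ A ])
    N  = annihilatorCount G A
    N′ = nullity-count (adj (G [ A ]))
    N-restrict : N * 2 ^ ∣ A ∣ ≡ N′ * 2 ^ n
    N-restrict = trans
      (cong (_* 2 ^ ∣ A ∣) (count-cong n λ c →
        does-⇔ (annihilates⇔vanishing G A c) (annihilates? G A c) (vanishing? (adj (G [ A ])) (restrict A c))))
      (count-restrict A (does ∘ vanishing? (adj (G [ A ]))))

  -- Kernel size times 2^rank is 2^(n + k) on one side and 2^n on the other, so a ratio 2^(k - s) of
  -- the kernel sizes leaves a rank difference of `s`.
  rk-from-counts : ∀ {n k} (H : Graph (n + k)) A′ (G : Graph n) A s →
    annihilatorCount H A′ * 2 ^ s ≡ annihilatorCount G A * 2 ^ k →
    rk (H [ A′ ]) ≡ s + rk (G [ A ])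
  rk-from-counts {n} {k} H A′ G A s ratio =
    ℕₚ.≤-antisym (2^-cancel-≤ (ℕₚ.≤-reflexive powers)) (2^-cancel-≤ (ℕₚ.≤-reflexive (sym powers)))
    where
    open ≡-Reasoning
    open import Algebra.Properties.CommutativeSemigroup ℕₚ.*-commutativeSemigroup using (xy∙z≈xz∙y)
    N = annihilatorCount G A
    N′ = annihilatorCount H A′
    r = rk (G [ A ])
    r′ = rk (H [ A′ ])

    instance
      N*2^k≢0 : NonZero (N * 2 ^ k)
      N*2^k≢0 = ℕₚ.m*n≢0 N (2 ^ k) {{N≢0}} {{ℕₚ.m^n≢0 2 k}}
        where
        N≢0 : NonZero N
        N≢0 = ℕₚ.m*n≢0⇒m≢0 N {{subst NonZero (sym (annihilatorCount-rk G A)) (ℕₚ.m^n≢0 2 n)}}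

    powers : 2 ^ r′ ≡ 2 ^ (s + r)
    powers = ℕₚ.*-cancelˡ-≡ _ _ (N * 2 ^ k) (begin
      N * 2 ^ k * 2 ^ r′          ≡⟨ cong (_* 2 ^ r′) ratio ⟨
      N′ * 2 ^ s * 2 ^ r′         ≡⟨ xy∙z≈xz∙y N′ (2 ^ s) _ ⟩
      N′ * 2 ^ r′ * 2 ^ s         ≡⟨ cong (_* 2 ^ s) (annihilatorCount-rk H A′) ⟩
      2 ^ (n + k) * 2 ^ s         ≡⟨ cong (_* 2 ^ s) (ℕₚ.^-distribˡ-+-* 2 n k) ⟩
      2 ^ n * 2 ^ k * 2 ^ s       ≡⟨ cong (λ t → t * 2 ^ k * 2 ^ s) (annihilatorCount-rk G A) ⟨
      N * 2 ^ r * 2 ^ k * 2 ^ s   ≡⟨ cong (_* 2 ^ s) (xy∙z≈xz∙y N (2 ^ r) _) ⟩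
      N * 2 ^ k * 2 ^ r * 2 ^ s   ≡⟨ ℕₚ.*-assoc (N * 2 ^ k) (2 ^ r) _ ⟩
      N * 2 ^ k * (2 ^ r * 2 ^ s) ≡⟨ cong (N * 2 ^ k *_) (ℕₚ.*-comm (2 ^ r) _) ⟩
      N * 2 ^ k * (2 ^ s * 2 ^ r) ≡⟨ cong (N * 2 ^ k *_) (ℕₚ.^-distribˡ-+-* 2 s r) ⟨
      N * 2 ^ k * 2 ^ (s + r)     ∎)

  -- All teeth have the same row, which is nonzero only at `a`; the selected ones therefore act on
  -- the column of `a` through this single bit.
  parity : ∀ {k} → Subset k → Subset k → Bool
  parity B d = sum𝔽₂ (λ b → lookup B b ∧ lookup d b)

  parity-empty : ∀ {k} (B d : Subset k) → (∀ b → lookup B b ≡ outside) → parity B d ≡ false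
  parity-empty {k} B d empty = trans (sum-cong-≗ λ b → cong (_∧ lookup d b) (empty b)) (sum-replicate-zero k)

  -- Flipping one entry of `d` at a position in `B` flips the parity, so both values are taken
  -- equally often.
  parity-equidistributed : ∀ {k} (B : Subset k) b → lookup B b ≡ inside → ∀ γ →
    count k (λ d → does (parity B d Boolₚ.≟ γ)) * 2 ≡ 2 ^ k
  parity-equidistributed {suc k} (inside ∷ B) zero _ γ = begin
    (count k (λ d → does (parity B d Boolₚ.≟ γ)) + count k (λ d → does (not (parity B d) Boolₚ.≟ γ))) * 2
      ≡⟨ cong (_* 2) (Σ⊆-+ k _ _) ⟨
    Σ⊆ k (λ d → indicator (does (parity B d Boolₚ.≟ γ)) + indicator (does (not (parity B d) Boolₚ.≟ γ))) * 2
      ≡⟨ cong (_* 2) (Σ⊆-cong k λ d → complementary (parity B d) γ) ⟩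
    Σ⊆ k (λ _ → 1) * 2
      ≡⟨ cong (_* 2) (trans (Σ⊆-const k 1) (ℕₚ.*-identityˡ (2 ^ k))) ⟩
    2 ^ k * 2
      ≡⟨ ℕₚ.*-comm (2 ^ k) 2 ⟩
    2 ^ suc k ∎
    where
    open ≡-Reasoning
    complementary : ∀ b γ → indicator (does (b Boolₚ.≟ γ)) + indicator (does (not b Boolₚ.≟ γ)) ≡ 1
    complementary false false = refl
    complementary false true  = refl
    complementary true  false = refl
    complementary true  true  = refl
  -- The head of the set already supplies a position to flip, so it replaces the given one.
  parity-equidistributed {suc k} (inside ∷ B) (suc b) _ γ = parity-equidistributed (inside ∷ B) zero refl γ
  parity-equidistributed {suc k} (outside ∷ B) (suc b) b∈B γ = begin
    (D + D₁) * 2       ≡⟨ ℕₚ.*-distribʳ-+ 2 D D₁ ⟩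
    D * 2 + D₁ * 2     ≡⟨ cong₂ _+_ IH (trans IH (sym (ℕₚ.+-identityʳ (2 ^ k)))) ⟩
    2 ^ suc k          ∎
    where
    open ≡-Reasoning
    D D₁ : ℕ
    D  = count k (λ d → does (parity (outside ∷ B) (false ∷ d) Boolₚ.≟ γ))
    D₁ = count k (λ d → does (parity (outside ∷ B) (true ∷ d) Boolₚ.≟ γ))
    IH : D * 2 ≡ 2 ^ k
    IH = parity-equidistributed B b b∈B γ

  -- Membership in `K` ignores the entry at `a`, so members come in pairs, exactly one of which has
  -- entry `false`.
  count-half : ∀ {n} (a : Fin (suc n)) (K : Subset (suc n) → Bool) →
    (∀ c → K (insertAt c a true) ≡ K (insertAt c a false)) →
    count (suc n) (λ c → does (lookup c a Boolₚ.≟ false) ∧ K c) * 2 ≡ count (suc n) K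
  count-half {n} a K invariant = begin
    count (suc n) (λ c → does (lookup c a Boolₚ.≟ false) ∧ K c) * 2
      ≡⟨ cong (_* 2) (Σ⊆-insertAt n a (λ c → indicator (does (lookup c a Boolₚ.≟ false) ∧ K c))) ⟩
    Σ⊆ n (λ c → indicator (does (lookup (insertAt c a false) a Boolₚ.≟ false) ∧ K (insertAt c a false))
              + indicator (does (lookup (insertAt c a true) a Boolₚ.≟ false) ∧ K (insertAt c a true))) * 2
      ≡⟨ cong (_* 2) (Σ⊆-cong n only-false) ⟩
    Σ⊆ n (λ c → indicator (K (insertAt c a false))) * 2
      ≡⟨ Σ⊆-*ʳ n 2 _ ⟨
    Σ⊆ n (λ c → indicator (K (insertAt c a false)) * 2)
      ≡⟨ Σ⊆-cong n both ⟩
    Σ⊆ n (λ c → indicator (K (insertAt c a false)) + indicator (K (insertAt c a true)))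
      ≡⟨ Σ⊆-insertAt n a (indicator ∘ K) ⟨
    count (suc n) K ∎
    where
    open ≡-Reasoning
    only-false : ∀ c →
      indicator (does (lookup (insertAt c a false) a Boolₚ.≟ false) ∧ K (insertAt c a false))
      + indicator (does (lookup (insertAt c a true) a Boolₚ.≟ false) ∧ K (insertAt c a true))
      ≡ indicator (K (insertAt c a false))
    only-false c rewrite Vecₚ.insertAt-lookup c a false | Vecₚ.insertAt-lookup c a true = ℕₚ.+-identityʳ _

    both : ∀ c → indicator (K (insertAt c a false)) * 2
               ≡ indicator (K (insertAt c a false)) + indicator (K (insertAt c a true))
    both c rewrite invariant c = trans (ℕₚ.*-comm i 2) (cong (i +_) (ℕₚ.+-identityʳ i))
      where i = indicator (K (insertAt c a false))

  insertAt-agree : ∀ {n} (c : Subset n) a b b′ i → i ≢ a → lookup (insertAt c a b) i ≡ lookup (insertAt c a b′) i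
  insertAt-agree c a b b′ i i≢a =
    subst (λ j → lookup (insertAt c a b) j ≡ lookup (insertAt c a b′) j)
      (Finₚ.punchIn-punchOut (i≢a ∘ sym))
      (trans (Vecₚ.insertAt-punchIn c a b _) (sym (Vecₚ.insertAt-punchIn c a b′ _)))

  column-cong : ∀ {n} (G : Graph n) {A A′ c c′ : Subset n} →
    (∀ i → lookup A i ∧ lookup c i ≡ lookup A′ i ∧ lookup c′ i) → ∀ j → column G A c j ≡ column G A′ c′ j
  column-cong G e j = sum-cong-≗ λ i → cong (_∧ adj G i j) (e i)

  ∀-++ : ∀ m n {P : Fin (m + n) → Set} → (∀ i → P (i ↑ˡ n)) → (∀ j → P (m ↑ʳ j)) → ∀ v → P v
  ∀-++ m n {P} left right v = subst P (Finₚ.join-splitAt m n v) ([_,_] {C = P ∘ join m n} left right (splitAt m v))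

  module _ {n} (k : ℕ) (G : Graph n) (a : Fin n) where
    private
      C = comb k G a

    adj-old-old : ∀ i j → adj C (i ↑ˡ k) (j ↑ˡ k) ≡ adj G i j
    adj-old-old i j rewrite Finₚ.splitAt-↑ˡ n i k | Finₚ.splitAt-↑ˡ n j k = refl

    adj-new-old : ∀ b j → adj C (n ↑ʳ b) (j ↑ˡ k) ≡ does (j Finₚ.≟ a)
    adj-new-old b j rewrite Finₚ.splitAt-↑ʳ n k b | Finₚ.splitAt-↑ˡ n j k = refl

    adj-old-new : ∀ i b → adj C (i ↑ˡ k) (n ↑ʳ b) ≡ does (i Finₚ.≟ a)
    adj-old-new i b rewrite Finₚ.splitAt-↑ʳ n k b | Finₚ.splitAt-↑ˡ n i k = refl

    adj-new-new : ∀ b b′ → adj C (n ↑ʳ b) (n ↑ʳ b′) ≡ false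
    adj-new-new b b′ rewrite Finₚ.splitAt-↑ʳ n k b | Finₚ.splitAt-↑ʳ n k b′ = refl

    module _ (A : Subset n) (B : Subset k) (c : Subset n) (d : Subset k) where

      column-split : ∀ v → column C (A ++ B) (c ++ d) v
        ≡ sum𝔽₂ (λ i → (lookup A i ∧ lookup c i) ∧ adj C (i ↑ˡ k) v)
          xor sum𝔽₂ (λ b → (lookup B b ∧ lookup d b) ∧ adj C (n ↑ʳ b) v)
      column-split v = trans (sum-++ n k _) (cong₂ _xor_
        (sum-cong-≗ λ i → cong (_∧ adj C (i ↑ˡ k) v) (cong₂ _∧_ (Vecₚ.lookup-++ˡ A B i) (Vecₚ.lookup-++ˡ c d i)))
        (sum-cong-≗ λ b → cong (_∧ adj C (n ↑ʳ b) v) (cong₂ _∧_ (Vecₚ.lookup-++ʳ A B b) (Vecₚ.lookup-++ʳ c d b))))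

      column-old : ∀ j → column C (A ++ B) (c ++ d) (j ↑ˡ k) ≡ column G A c j xor (parity B d ∧ does (j Finₚ.≟ a))
      column-old j = trans (column-split (j ↑ˡ k)) (cong₂ _xor_
        (sum-cong-≗ λ i → cong ((lookup A i ∧ lookup c i) ∧_) (adj-old-old i j))
        (trans (sum-cong-≗ λ b → cong ((lookup B b ∧ lookup d b) ∧_) (adj-new-old b j))
               (sym (*-distribʳ-sum (does (j Finₚ.≟ a)) (λ b → lookup B b ∧ lookup d b)))))

      -- The only neighbour of a tooth is `a`, so a single term survives.
      column-new : ∀ b → column C (A ++ B) (c ++ d) (n ↑ʳ b) ≡ lookup A a ∧ lookup c a
      column-new b = begin
        column C (A ++ B) (c ++ d) (n ↑ʳ b)
          ≡⟨ column-split (n ↑ʳ b) ⟩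
        sum𝔽₂ (λ i → (lookup A i ∧ lookup c i) ∧ adj C (i ↑ˡ k) (n ↑ʳ b))
        xor sum𝔽₂ (λ b′ → (lookup B b′ ∧ lookup d b′) ∧ adj C (n ↑ʳ b′) (n ↑ʳ b))
          ≡⟨ cong₂ _xor_
              (trans (sum-cong-≗ λ i → cong ((lookup A i ∧ lookup c i) ∧_) (adj-old-new i b))
                     (sum-point a (λ i → lookup A i ∧ lookup c i)))
              (trans (sum-cong-≗ λ b′ → trans (cong ((lookup B b′ ∧ lookup d b′) ∧_) (adj-new-new b′ b))
                                              (Boolₚ.∧-zeroʳ (lookup B b′ ∧ lookup d b′)))
                     (sum-replicate-zero k)) ⟩
        (lookup A a ∧ lookup c a) xor false
          ≡⟨ Boolₚ.xor-identityʳ _ ⟩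
        lookup A a ∧ lookup c a ∎
        where open ≡-Reasoning

      annihilates-comb :
        Annihilates C (A ++ B) (c ++ d) ⇔
        ((∀ j → lookup A j ≡ inside → column G A c j xor (parity B d ∧ does (j Finₚ.≟ a)) ≡ false)
         × (∀ b → lookup B b ≡ inside → lookup A a ∧ lookup c a ≡ false))
      annihilates-comb = mk⇔
        (λ ann → (λ j j∈A → trans (sym (column-old j)) (ann (j ↑ˡ k) (trans (Vecₚ.lookup-++ˡ A B j) j∈A)))
               , (λ b b∈B → trans (sym (column-new b)) (ann (n ↑ʳ b) (trans (Vecₚ.lookup-++ʳ A B b) b∈B))))
        (λ (old , new) → ∀-++ n k
          (λ j j∈A → trans (column-old j) (old j (trans (sym (Vecₚ.lookup-++ˡ A B j)) j∈A)))
          (λ b b∈B → trans (column-new b) (new b (trans (sym (Vecₚ.lookup-++ʳ A B b)) b∈B))))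

    -- The hypothesis covers both `a` outside `A` and `B` empty. Either way the tooth coefficients
    -- `d` enter no condition, so the kernel grows by the factor 2^k that the larger ambient space
    -- contributes.
    rk-comb-detached : ∀ A B → (∀ b → lookup B b ≡ inside → lookup A a ≡ outside) →
      rk (C [ A ++ B ]) ≡ rk (G [ A ])
    rk-comb-detached A B detached = rk-from-counts C (A ++ B) G A 0 (begin
      annihilatorCount C (A ++ B) * 1
        ≡⟨ ℕₚ.*-identityʳ _ ⟩
      annihilatorCount C (A ++ B)
        ≡⟨ Σ⊆-++ n k _ ⟩
      Σ⊆ n (λ c → Σ⊆ k (λ d → indicator (does (annihilates? C (A ++ B) (c ++ d)))))
        ≡⟨ Σ⊆-cong n (λ c → trans (count-cong k (same c)) (Σ⊆-const k _)) ⟩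
      Σ⊆ n (λ c → indicator (does (annihilates? G A c)) * 2 ^ k)
        ≡⟨ Σ⊆-*ʳ n (2 ^ k) _ ⟩
      annihilatorCount G A * 2 ^ k ∎)
      where
      open ≡-Reasoning
      teeth-vanish : ∀ d j → lookup A j ≡ inside → parity B d ∧ does (j Finₚ.≟ a) ≡ false
      teeth-vanish d j j∈A with j Finₚ.≟ a
      ... | no _     = Boolₚ.∧-zeroʳ (parity B d)
      -- Since `a` lies in `A` here, the hypothesis leaves no tooth in `B`.
      ... | yes refl = trans (Boolₚ.∧-identityʳ _) (parity-empty B d λ b →
        Boolₚ.¬-not λ b∈B → contradiction (trans (sym j∈A) (detached b b∈B)) λ ())

      same : ∀ c d → does (annihilates? C (A ++ B) (c ++ d)) ≡ does (annihilates? G A c)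
      same c d = does-⇔ (mk⇔
        (λ ann j j∈A → trans (sym (old j j∈A)) (proj₁ (Equivalence.to (annihilates-comb A B c d) ann) j j∈A))
        (λ ann → Equivalence.from (annihilates-comb A B c d)
          ( (λ j j∈A → trans (old j j∈A) (ann j j∈A))
          , (λ b b∈B → cong (_∧ lookup c a) (detached b b∈B)))))
        (annihilates? C (A ++ B) (c ++ d)) (annihilates? G A c)
        where
        old : ∀ j → lookup A j ≡ inside → column G A c j xor (parity B d ∧ does (j Finₚ.≟ a)) ≡ column G A c j
        old j j∈A = trans (cong (column G A c j xor_) (teeth-vanish d j j∈A)) (Boolₚ.xor-identityʳ _)

  -- Compared with annihilators of `A₀` with arbitrary `d`, two independent bits are fixed: the
  -- entry of `c` at `a` must be zero, and the parity of `d` on `B` must cancel the column of `a`.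
  -- Two halvings of the kernel raise the rank by 2.
  rk-comb-attached : ∀ {n} (k : ℕ) (G : Graph (suc n)) (a : Fin (suc n)) (A : Subset n) (B : Subset k) b →
    lookup B b ≡ inside →
    rk (comb k G a [ insertAt A a inside ++ B ]) ≡ 2 + rk (G [ insertAt A a outside ])
  rk-comb-attached {n} k G a A B b b∈B = rk-from-counts C (A₁ ++ B) G A₀ 2 (begin
    annihilatorCount C (A₁ ++ B) * 4
      ≡⟨ cong (_* 4) (Σ⊆-++ (suc n) k (indicator ∘ does ∘ annihilates? C (A₁ ++ B))) ⟩
    Σ⊆ (suc n) fibre * 4
      ≡⟨ ℕₚ.*-assoc (Σ⊆ (suc n) fibre) 2 2 ⟨
    -- The factor 4 is spent in two places: one 2 on the parity of `d`, the other on the entry of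
    -- `c` at `a`.
    Σ⊆ (suc n) fibre * 2 * 2
      ≡⟨ cong (_* 2) (Σ⊆-*ʳ (suc n) 2 fibre) ⟨
    Σ⊆ (suc n) (λ c → fibre c * 2) * 2
      ≡⟨ cong (_* 2) (Σ⊆-cong (suc n) count-teeth) ⟩
    Σ⊆ (suc n) (λ c → indicator (base c) * 2 ^ k) * 2
      ≡⟨ cong (_* 2) (Σ⊆-*ʳ (suc n) (2 ^ k) (indicator ∘ base)) ⟩
    H * 2 ^ k * 2
      ≡⟨ xy∙z≈xz∙y H (2 ^ k) 2 ⟩
    H * 2 * 2 ^ k
      ≡⟨ cong (_* 2 ^ k) (count-half a (does ∘ annihilates? G A₀) invariant) ⟩
    annihilatorCount G A₀ * 2 ^ k ∎)
    where
    open ≡-Reasoning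
    open import Algebra.Properties.CommutativeSemigroup ℕₚ.*-commutativeSemigroup using (xy∙z≈xz∙y)
    C = comb k G a
    A₀ = insertAt A a outside
    A₁ = insertAt A a inside

    base : Subset (suc n) → Bool
    base c = does (lookup c a Boolₚ.≟ false) ∧ does (annihilates? G A₀ c)

    fibre : Subset (suc n) → ℕ
    fibre c = count k (λ d → does (annihilates? C (A₁ ++ B) (c ++ d)))

    H = count (suc n) base

    a∉A₀ : lookup A₀ a ≡ outside
    a∉A₀ = Vecₚ.insertAt-lookup A a outside

    a∈A₁ : lookup A₁ a ≡ inside
    a∈A₁ = Vecₚ.insertAt-lookup A a inside

    invariant : ∀ c → does (annihilates? G A₀ (insertAt c a true)) ≡ does (annihilates? G A₀ (insertAt c a false))
    invariant c = does-⇔ (mk⇔ (λ ann j j∈ → trans (sym (column-eq j)) (ann j j∈))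
                              (λ ann j j∈ → trans (column-eq j) (ann j j∈)))
      (annihilates? G A₀ (insertAt c a true)) (annihilates? G A₀ (insertAt c a false))
      where
      masked : ∀ i → lookup A₀ i ∧ lookup (insertAt c a true) i ≡ lookup A₀ i ∧ lookup (insertAt c a false) i
      masked i with i Finₚ.≟ a
      ... | yes refl rewrite a∉A₀ = refl
      ... | no i≢a   = cong (lookup A₀ i ∧_) (insertAt-agree c a true false i i≢a)
      column-eq = column-cong G {A₀} {A₀} {insertAt c a true} {insertAt c a false} masked

    module _ (c : Subset (suc n)) (d : Subset k) where

      column-A₁ : lookup c a ≡ false → ∀ j → column G A₁ c j ≡ column G A₀ c j
      column-A₁ cₐ = column-cong G {A₁} {A₀} {c} {c} masked
        where
        masked : ∀ i → lookup A₁ i ∧ lookup c i ≡ lookup A₀ i ∧ lookup c i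
        masked i with i Finₚ.≟ a
        ... | yes refl rewrite cₐ = trans (Boolₚ.∧-zeroʳ (lookup A₁ i)) (sym (Boolₚ.∧-zeroʳ (lookup A₀ i)))
        ... | no i≢a   = cong (_∧ lookup c i) (insertAt-agree A a inside outside i i≢a)

      -- The teeth in `B` demand that `c` vanish at `a`, after which `A₁` and `A₀` have equal
      -- columns. The old columns then split: the one at `a` fixes the parity, the others are the
      -- conditions for `A₀`.
      conditions : Annihilates C (A₁ ++ B) (c ++ d) ⇔
        ((lookup c a ≡ false × Annihilates G A₀ c) × parity B d ≡ column G A₁ c a)
      conditions = mk⇔ forth back
        where
        forth : Annihilates C (A₁ ++ B) (c ++ d) →
          (lookup c a ≡ false × Annihilates G A₀ c) × parity B d ≡ column G A₁ c a
        forth ann with old , new ← Equivalence.to (annihilates-comb k G a A₁ B c d) ann =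
          (cₐ , rest) , sym (xor≡false (begin
            column G A₁ c a xor parity B d
              ≡⟨ cong (column G A₁ c a xor_) (Boolₚ.∧-identityʳ (parity B d)) ⟨
            column G A₁ c a xor (parity B d ∧ true)
              ≡⟨ cong (λ t → column G A₁ c a xor (parity B d ∧ t)) (dec-true (a Finₚ.≟ a) refl) ⟨
            column G A₁ c a xor (parity B d ∧ does (a Finₚ.≟ a))
              ≡⟨ old a a∈A₁ ⟩
            false ∎))
          where
          cₐ : lookup c a ≡ false
          -- The selected tooth `b` is used here: its column is the entry of `c` at `a`.
          cₐ = trans (cong (_∧ lookup c a) (sym a∈A₁)) (new b b∈B)
          rest : Annihilates G A₀ c
          rest j j∈A₀ with j Finₚ.≟ a | old j
          ... | yes refl | _ = contradiction (trans (sym j∈A₀) a∉A₀) λ ()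
          ... | no j≢a   | oldⱼ = begin
            column G A₀ c j                            ≡⟨ column-A₁ cₐ j ⟨
            column G A₁ c j                            ≡⟨ Boolₚ.xor-identityʳ _ ⟨
            column G A₁ c j xor false                  ≡⟨ cong (column G A₁ c j xor_) (Boolₚ.∧-zeroʳ (parity B d)) ⟨
            column G A₁ c j xor (parity B d ∧ false)   ≡⟨ oldⱼ (trans (insertAt-agree A a inside outside j j≢a) j∈A₀) ⟩
            false                                      ∎

        back : (lookup c a ≡ false × Annihilates G A₀ c) × parity B d ≡ column G A₁ c a →
          Annihilates C (A₁ ++ B) (c ++ d)
        back ((cₐ , ann) , β) = Equivalence.from (annihilates-comb k G a A₁ B c d)
          (old , λ _ _ → trans (cong (lookup A₁ a ∧_) cₐ) (Boolₚ.∧-zeroʳ (lookup A₁ a)))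
          where
          old : ∀ j → lookup A₁ j ≡ inside → column G A₁ c j xor (parity B d ∧ does (j Finₚ.≟ a)) ≡ false
          old j j∈A₁ with j Finₚ.≟ a
          ... | yes refl = trans (cong (λ t → column G A₁ c j xor t) (trans (Boolₚ.∧-identityʳ _) β))
                                 (Boolₚ.xor-same (column G A₁ c j))
          ... | no j≢a   = begin
            column G A₁ c j xor (parity B d ∧ false)   ≡⟨ cong (column G A₁ c j xor_) (Boolₚ.∧-zeroʳ (parity B d)) ⟩
            column G A₁ c j xor false                  ≡⟨ Boolₚ.xor-identityʳ _ ⟩
            column G A₁ c j                            ≡⟨ column-A₁ cₐ j ⟩
            column G A₀ c j                            ≡⟨ ann j (trans (insertAt-agree A a outside inside j j≢a) j∈A₁) ⟩
            false                                      ∎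

    count-teeth : ∀ c → fibre c * 2 ≡ indicator (base c) * 2 ^ k
    count-teeth c = trans
      (cong (_* 2) (count-cong k λ d → does-⇔ (conditions c d) (annihilates? C (A₁ ++ B) (c ++ d))
        ((lookup c a Boolₚ.≟ false ×-dec annihilates? G A₀ c) ×-dec (parity B d Boolₚ.≟ column G A₁ c a))))
      (conditional (base c))
      where
      conditional : ∀ t → count k (λ d → t ∧ does (parity B d Boolₚ.≟ column G A₁ c a)) * 2 ≡ indicator t * 2 ^ k
      conditional true  = trans (parity-equidistributed B b b∈B (column G A₁ c a)) (sym (ℕₚ.*-identityˡ (2 ^ k)))
      conditional false = cong (_* 2) (Σ⊆-const k 0)

-- The weighted polynomial and its behaviour under combs.

module WeightedPolynomial (R : CommutativeRing 0ℓ 0ℓ) (u x : CommutativeRing.Carrier R) where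
  open CommutativeRing R hiding (refl; sym; trans; zero)
  open CommutativeRing R using () renaming (refl to ≈-refl; sym to ≈-sym; trans to ≈-trans)
  open Evaluation R
  open import Algebra.Properties.Semiring.Exp semiring using (^-congʳ; ^-homo-*)
  open import Algebra.Properties.CommutativeSemigroup *-commutativeSemigroup using (x∙yz≈y∙xz)
  open SubsetSums commutativeSemiring
  open import Relation.Binary.Reasoning.Setoid setoid
  open import Algebra.Solver.Ring.NaturalCoefficients.Default commutativeSemiring
    using (solve; _:=_; _:+_; _:*_; con)

  weight : ∀ {n} → (Fin n → Carrier) → Subset n → Carrier
  weight w []            = 1#
  weight w (inside  ∷ A) = x * weight (w ∘ suc) A
  weight w (outside ∷ A) = w zero * weight (w ∘ suc) A

  term : ∀ {n} → Graph n → (Fin n → Carrier) → Subset n → Carrier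
  term G w A = weight w A * u ^ rk (G [ A ])

  W : ∀ {n} → Graph n → (Fin n → Carrier) → Carrier
  W {n} G w = Σ⊆ n (term G w)

  weight-cong : ∀ {n} {w w′ : Fin n → Carrier} → (∀ i → w i ≈ w′ i) → ∀ A → weight w A ≈ weight w′ A
  weight-cong e []            = ≈-refl
  weight-cong e (inside  ∷ A) = *-congˡ (weight-cong (e ∘ suc) A)
  weight-cong e (outside ∷ A) = *-cong (e zero) (weight-cong (e ∘ suc) A)

  weight-one : ∀ {n} {w : Fin n → Carrier} → (∀ i → w i ≈ 1#) → ∀ A → weight w A ≈ x ^ ∣ A ∣
  weight-one e []            = ≈-refl
  weight-one e (inside  ∷ A) = *-congˡ (weight-one (e ∘ suc) A)
  weight-one e (outside ∷ A) = ≈-trans (*-cong (e zero) (weight-one (e ∘ suc) A)) (*-identityˡ _)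

  weight-++ : ∀ {m n} (w : Fin (m ℕ.+ n) → Carrier) (A : Subset m) (B : Subset n) →
    weight w (A ++ B) ≈ weight (λ i → w (i ↑ˡ n)) A * weight (λ j → w (m ↑ʳ j)) B
  weight-++ w []            B = ≈-sym (*-identityˡ _)
  weight-++ w (inside  ∷ A) B = ≈-trans (*-congˡ (weight-++ (w ∘ suc) A B)) (≈-sym (*-assoc _ _ _))
  weight-++ w (outside ∷ A) B = ≈-trans (*-congˡ (weight-++ (w ∘ suc) A B)) (≈-sym (*-assoc _ _ _))

  weight-insertAt : ∀ {n} (w : Fin (suc n) → Carrier) (A : Subset n) a b →
    weight w (insertAt A a b) ≈ (if b then x else w a) * weight (w ∘ punchIn a) A
  weight-insertAt w A             zero    inside  = ≈-refl
  weight-insertAt w A             zero    outside = ≈-refl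
  weight-insertAt w (inside  ∷ A) (suc a) b =
    ≈-trans (*-congˡ (weight-insertAt (w ∘ suc) A a b)) (x∙yz≈y∙xz _ _ _)
  weight-insertAt w (outside ∷ A) (suc a) b =
    ≈-trans (*-congˡ (weight-insertAt (w ∘ suc) A a b)) (x∙yz≈y∙xz _ _ _)

  P≈W : ∀ {n} (G : Graph n) {w} → (∀ i → w i ≈ 1#) → P G u x ≈ W G w
  P≈W {n} G e = ≈-trans (Σ⊆-foldr n _) (Σ⊆-cong n λ A → *-congʳ (≈-sym (weight-one e A)))

  W-cong : ∀ {n} (G : Graph n) {w w′} → (∀ i → w i ≈ w′ i) → W G w ≈ W G w′
  W-cong {n} G e = Σ⊆-cong n λ A → *-congʳ (weight-cong e A)

  Σ-powers : ∀ k → Σ⊆ k (λ B → x ^ ∣ B ∣) ≈ (1# + x) ^ k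
  Σ-powers zero    = ≈-refl
  Σ-powers (suc k) = begin
    Σ⊆ k (λ B → x ^ ∣ B ∣) + Σ⊆ k (λ B → x * x ^ ∣ B ∣)   ≈⟨ +-congˡ (Σ⊆-*ˡ k x _) ⟩
    Σ⊆ k (λ B → x ^ ∣ B ∣) + x * Σ⊆ k (λ B → x ^ ∣ B ∣)   ≈⟨ +-cong (Σ-powers k) (*-congˡ (Σ-powers k)) ⟩
    (1# + x) ^ k + x * (1# + x) ^ k                       ≈⟨ +-congʳ (*-identityˡ _) ⟨
    1# * (1# + x) ^ k + x * (1# + x) ^ k                  ≈⟨ distribʳ _ 1# x ⟨
    (1# + x) * (1# + x) ^ k                               ∎

  -- This is (1 + x)^k - 1, written without subtraction so that the semiring solver applies.
  nonemptyPowers : ℕ → Carrier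
  nonemptyPowers zero    = 0#
  nonemptyPowers (suc k) = nonemptyPowers k + x * (1# + x) ^ k

  1+nonemptyPowers : ∀ k → 1# + nonemptyPowers k ≈ (1# + x) ^ k
  1+nonemptyPowers zero    = +-identityʳ 1#
  1+nonemptyPowers (suc k) = begin
    1# + (nonemptyPowers k + x * (1# + x) ^ k)   ≈⟨ +-assoc _ _ _ ⟨
    1# + nonemptyPowers k + x * (1# + x) ^ k     ≈⟨ +-congʳ (≈-trans (1+nonemptyPowers k) (≈-sym (*-identityˡ _))) ⟩
    1# * (1# + x) ^ k + x * (1# + x) ^ k         ≈⟨ distribʳ _ 1# x ⟨
    (1# + x) * (1# + x) ^ k                      ∎

  -- With `a` selected, the rank depends on the set of teeth only through its being empty or not;
  -- `α` and `β` will be the two resulting powers of `u`.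
  Σ-split-empty : ∀ k (g : Subset k → Carrier) α β →
    (∀ B → (∀ b → lookup B b ≡ outside) → g B ≈ α) →
    (∀ B b → lookup B b ≡ inside → g B ≈ β) →
    Σ⊆ k (λ B → x ^ ∣ B ∣ * g B) ≈ α + nonemptyPowers k * β
  Σ-split-empty zero g α β empty nonempty = begin
    1# * g []     ≈⟨ *-identityˡ _ ⟩
    g []          ≈⟨ empty [] (λ ()) ⟩
    α             ≈⟨ +-identityʳ α ⟨
    α + 0#        ≈⟨ +-congˡ (zeroˡ β) ⟨
    α + 0# * β    ∎
  Σ-split-empty (suc k) g α β empty nonempty = begin
    Σ⊆ k (λ B → x ^ ∣ B ∣ * g (outside ∷ B)) + Σ⊆ k (λ B → x * x ^ ∣ B ∣ * g (inside ∷ B))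
      ≈⟨ +-cong
          (Σ-split-empty k (g ∘ (outside ∷_)) α β
            (λ B e → empty (outside ∷ B) λ { zero → refl ; (suc b) → e b })
            (λ B b → nonempty (outside ∷ B) (suc b)))
          (Σ⊆-cong k λ B → *-congˡ (nonempty (inside ∷ B) zero refl)) ⟩
    α + nonemptyPowers k * β + Σ⊆ k (λ B → x * x ^ ∣ B ∣ * β)
      ≈⟨ +-congˡ (≈-trans (Σ⊆-*ʳ k β _) (*-congʳ (≈-trans (Σ⊆-*ˡ k x _) (*-congˡ (Σ-powers k))))) ⟩
    α + nonemptyPowers k * β + x * (1# + x) ^ k * β
      ≈⟨ ≈-trans (+-assoc _ _ _) (+-congˡ (≈-sym (distribʳ β _ _))) ⟩
    α + (nonemptyPowers k + x * (1# + x) ^ k) * β ∎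

  -- The first summand comes from sets avoiding `a`, with arbitrary teeth. The second comes from
  -- sets with `a` and at least one tooth: `a` gives `x`, the two extra ranks give `u ^ 2`. Both
  -- multiply the rank power of the graph without `a`, so together they act as one weight of an
  -- absent `a`.
  step : ℕ → Carrier → Carrier
  step k t = t * (1# + x) ^ k + x * u ^ 2 * nonemptyPowers k

  step-one : ∀ k → step k 1# ≈ p k u x
  step-one k = x≈z//y _ _ _ (begin
    step k 1# + x * u ^ 2
      ≈⟨ +-congʳ (+-congʳ (*-congˡ (≈-sym (1+nonemptyPowers k)))) ⟩
    1# * (1# + e) + x * u ^ 2 * e + x * u ^ 2
      ≈⟨ solve 2 (λ e v → con 1 :* (con 1 :+ e) :+ v :* e :+ v := (con 1 :+ e) :* (v :+ con 1)) ≈-refl e (x * u ^ 2) ⟩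
    (1# + e) * (x * u ^ 2 + 1#)
      ≈⟨ *-congʳ (1+nonemptyPowers k) ⟩
    (1# + x) ^ k * (x * u ^ 2 + 1#) ∎)
    where
    open import Algebra.Properties.Group +-group using (x≈z//y)
    e = nonemptyPowers k

  module _ {n} (k : ℕ) (G : Graph (suc n)) (a : Fin (suc n)) where
    private
      C = comb k G a

    teeth : Subset (suc n) → Carrier
    teeth A = Σ⊆ k (λ B → x ^ ∣ B ∣ * u ^ rk (C [ A ++ B ]))

    teeth-outside : ∀ A → teeth (insertAt A a outside) ≈ (1# + x) ^ k * u ^ rk (G [ insertAt A a outside ])
    teeth-outside A = begin
      Σ⊆ k (λ B → x ^ ∣ B ∣ * u ^ rk (C [ A₀ ++ B ]))
        ≈⟨ Σ⊆-cong k (λ B → *-congˡ (^-congʳ u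
             (CombRanks.rk-comb-detached k G a A₀ B λ _ _ → Vecₚ.insertAt-lookup A a outside))) ⟩
      Σ⊆ k (λ B → x ^ ∣ B ∣ * u ^ rk (G [ A₀ ]))
        ≈⟨ Σ⊆-*ʳ k _ (λ B → x ^ ∣ B ∣) ⟩
      Σ⊆ k (λ B → x ^ ∣ B ∣) * u ^ rk (G [ A₀ ])
        ≈⟨ *-congʳ (Σ-powers k) ⟩
      (1# + x) ^ k * u ^ rk (G [ A₀ ]) ∎
      where A₀ = insertAt A a outside

    teeth-inside : ∀ A → teeth (insertAt A a inside)
      ≈ u ^ rk (G [ insertAt A a inside ]) + nonemptyPowers k * (u ^ 2 * u ^ rk (G [ insertAt A a outside ]))
    teeth-inside A = Σ-split-empty k _ _ _
      (λ B empty → ^-congʳ u (CombRanks.rk-comb-detached k G a (insertAt A a inside) B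
        λ b b∈B → contradiction (trans (sym b∈B) (empty b)) λ ()))
      (λ B b b∈B → ≈-trans (^-congʳ u (CombRanks.rk-comb-attached k G a A B b b∈B))
                             (^-homo-* u 2 (rk (G [ insertAt A a outside ]))))

    -- Weight 1 on the teeth makes the sum over their subsets a sum of plain powers of `x`. The
    -- remaining sum is paired by whether `a` is selected, and each pair is matched separately.
    W-comb-suc : ∀ (w : Fin (suc n ℕ.+ k) → Carrier) (w′ : Fin (suc n) → Carrier) →
      (∀ b → w (suc n ↑ʳ b) ≈ 1#) → w′ a ≈ step k (w (a ↑ˡ k)) → (∀ i → i ≢ a → w′ i ≈ w (i ↑ˡ k)) →
      W C w ≈ W G w′
    W-comb-suc w w′ new at-a off-a = begin
      W C w
        ≈⟨ Σ⊆-++ (suc n) k (term C w) ⟩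
      Σ⊆ (suc n) (λ A → Σ⊆ k (λ B → term C w (A ++ B)))
        ≈⟨ Σ⊆-cong (suc n) factor ⟩
      Σ⊆ (suc n) (λ A → weight old A * teeth A)
        ≈⟨ Σ⊆-insertAt n a (λ A → weight old A * teeth A) ⟩
      Σ⊆ n (λ A → weight old (insertAt A a outside) * teeth (insertAt A a outside)
                + weight old (insertAt A a inside) * teeth (insertAt A a inside))
        ≈⟨ Σ⊆-cong n regroup ⟩
      Σ⊆ n (λ A → term G w′ (insertAt A a outside) + term G w′ (insertAt A a inside))
        ≈⟨ Σ⊆-insertAt n a (term G w′) ⟨
      W G w′ ∎
      where
      old : Fin (suc n) → Carrier
      old i = w (i ↑ˡ k)

      factor : ∀ A → Σ⊆ k (λ B → term C w (A ++ B)) ≈ weight old A * teeth A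
      factor A = ≈-trans
        (Σ⊆-cong k λ B → ≈-trans (*-congʳ (≈-trans (weight-++ w A B) (*-congˡ (weight-one new B)))) (*-assoc _ _ _))
        (Σ⊆-*ˡ k (weight old A) _)

      regroup : ∀ A →
        weight old (insertAt A a outside) * teeth (insertAt A a outside)
        + weight old (insertAt A a inside) * teeth (insertAt A a inside)
        ≈ term G w′ (insertAt A a outside) + term G w′ (insertAt A a inside)
      regroup A = begin
        weight old (insertAt A a outside) * teeth (insertAt A a outside)
        + weight old (insertAt A a inside) * teeth (insertAt A a inside)
          ≈⟨ +-cong (*-cong (weight-insertAt old A a outside) (teeth-outside A))
                    (*-cong (weight-insertAt old A a inside) (teeth-inside A)) ⟩
        old a * π * (E * U₀) + x * π * (U₁ + e * (u ^ 2 * U₀))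
          -- The part with `a` and a nonempty set of teeth carries `U₀`, so it moves over to the
          -- term without `a` and completes `step k (old a)`.
          ≈⟨ solve 8 (λ t π E U₀ U₁ e x v →
               t :* π :* (E :* U₀) :+ x :* π :* (U₁ :+ e :* (v :* U₀))
               := (t :* E :+ x :* v :* e) :* π :* U₀ :+ x :* π :* U₁)
               ≈-refl (old a) π E U₀ U₁ e x (u ^ 2) ⟩
        step k (old a) * π * U₀ + x * π * U₁
          ≈⟨ +-cong (*-congʳ (*-cong (≈-sym at-a) π≈π′)) (*-congʳ (*-congˡ π≈π′)) ⟩
        w′ a * π′ * U₀ + x * π′ * U₁
          ≈⟨ +-cong (*-congʳ (weight-insertAt w′ A a outside)) (*-congʳ (weight-insertAt w′ A a inside)) ⟨
        weight w′ (insertAt A a outside) * U₀ + weight w′ (insertAt A a inside) * U₁ ∎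
        where
        π  = weight (old ∘ punchIn a) A
        π′ = weight (w′ ∘ punchIn a) A
        E  = (1# + x) ^ k
        e  = nonemptyPowers k
        U₀ = u ^ rk (G [ insertAt A a outside ])
        U₁ = u ^ rk (G [ insertAt A a inside ])
        π≈π′ : π ≈ π′
        π≈π′ = weight-cong (λ i → ≈-sym (off-a (punchIn a i) (Finₚ.punchInᵢ≢i a i))) A

  W-comb : ∀ {n} k (G : Graph n) a (w : Fin (n ℕ.+ k) → Carrier) (w′ : Fin n → Carrier) →
    (∀ b → w (n ↑ʳ b) ≈ 1#) → w′ a ≈ step k (w (a ↑ˡ k)) → (∀ i → i ≢ a → w′ i ≈ w (i ↑ˡ k)) →
    W (comb k G a) w ≈ W G w′
  W-comb {suc n} = W-comb-suc

  -- Each occurrence of `v` in the list applies `step k` once, starting from the weight 1 of a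
  -- vertex that is never combed.
  combWeight : ∀ {n l} → ℕ → Vec (Fin n) l → Fin n → Carrier
  combWeight k []       v = 1#
  combWeight k (a ∷ as) v = if does (v Finₚ.≟ a) then step k (combWeight k as v) else combWeight k as v

  combWeight-map : ∀ {m n l} k (f : Fin m → Fin n) → (∀ {i j} → f i ≡ f j → i ≡ j) →
    ∀ (as : Vec (Fin m) l) v → combWeight k (Vec.map f as) (f v) ≡ combWeight k as v
  combWeight-map k f inj []       v = refl
  combWeight-map k f inj (a ∷ as) v
    rewrite does-⇔ (mk⇔ inj (cong f)) (f v Finₚ.≟ f a) (v Finₚ.≟ a) | combWeight-map k f inj as v = refl

  -- Later combs are made only at images of old vertices, so fresh teeth keep the weight 1 that
  -- `W-comb` requires.
  combWeight-outside : ∀ {m n l} k (f : Fin m → Fin n) v → (∀ i → v ≢ f i) →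
    ∀ (as : Vec (Fin m) l) → combWeight k (Vec.map f as) v ≡ 1#
  combWeight-outside k f v v∉f []       = refl
  combWeight-outside k f v v∉f (a ∷ as)
    rewrite dec-false (v Finₚ.≟ f a) (v∉f a) = combWeight-outside k f v v∉f as

  -- The induction hypothesis is applied to the enlarged graph `comb k G a`, so combs are removed in
  -- the reverse of the order in which they were made.
  P-combs : ∀ {n l} k (G : Graph n) (as : Vec (Fin n) l) → P (combs k G as) u x ≈ W G (combWeight k as)
  P-combs k G [] = P≈W G λ _ → ≈-refl
  P-combs {n} k G (a ∷ as) = ≈-trans (P-combs k (comb k G a) (Vec.map (_↑ˡ k) as))
    (W-comb k G a _ _
      (λ b → reflexive (combWeight-outside k (_↑ˡ k) (n ↑ʳ b) (new≢old b) as))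
      at-a off-a)
    where
    new≢old : ∀ b i → n ↑ʳ b ≢ i ↑ˡ k
    new≢old b i e with () ← trans (sym (Finₚ.splitAt-↑ʳ n k b)) (trans (cong (splitAt n) e) (Finₚ.splitAt-↑ˡ n i k))

    old-weight : ∀ i → combWeight k (Vec.map (_↑ˡ k) as) (i ↑ˡ k) ≡ combWeight k as i
    old-weight = combWeight-map k (_↑ˡ k) (λ {i} {j} → Finₚ.↑ˡ-injective k i j) as

    at-a : combWeight k (a ∷ as) a ≈ step k (combWeight k (Vec.map (_↑ˡ k) as) (a ↑ˡ k))
    at-a rewrite old-weight a | dec-true (a Finₚ.≟ a) refl = ≈-refl

    off-a : ∀ i → i ≢ a → combWeight k (a ∷ as) i ≈ combWeight k (Vec.map (_↑ˡ k) as) (i ↑ˡ k)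
    off-a i i≢a rewrite old-weight i | dec-false (i Finₚ.≟ a) i≢a = ≈-refl

  -- Every vertex occurs exactly once in `Vec.allFin n`, so its weight is `step k 1#`.
  combWeight-allFin : ∀ {n} k (v : Fin n) → combWeight k (Vec.allFin n) v ≈ p k u x
  combWeight-allFin {suc n} k zero
    rewrite Vecₚ.tabulate-allFin {n = n} Fin.suc | combWeight-outside k Fin.suc zero (λ _ ()) (Vec.allFin n) = step-one k
  combWeight-allFin {suc n} k (suc v)
    rewrite Vecₚ.tabulate-allFin {n = n} Fin.suc | combWeight-map k Fin.suc Finₚ.suc-injective (Vec.allFin n) v =
      combWeight-allFin k v

  -- One factor `q` goes to each vertex: at a selected vertex it combines with `y` to give `x`, at
  -- an absent one it is the weight.
  weight-const : ∀ {n} q y → y * q ≈ x → (A : Subset n) → q ^ n * y ^ ∣ A ∣ ≈ weight (λ _ → q) A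
  weight-const q y yq≈x []                    = *-identityˡ 1#
  weight-const {suc n} q y yq≈x (inside  ∷ A) = begin
    q * q ^ n * (y * y ^ ∣ A ∣)   ≈⟨ solve 4 (λ q r y z → q :* r :* (y :* z) := y :* q :* (r :* z)) ≈-refl q _ y _ ⟩
    y * q * (q ^ n * y ^ ∣ A ∣)   ≈⟨ *-cong yq≈x (weight-const q y yq≈x A) ⟩
    x * weight (λ _ → q) A        ∎
  weight-const {suc n} q y yq≈x (outside ∷ A) = ≈-trans (*-assoc _ _ _) (*-congˡ (weight-const q y yq≈x A))

  -- `y` stands for the quotient of `x` by `p k u x`, given by its defining equation so that the
  -- argument runs in a ring without division.
  P-combEverywhere : ∀ {n} k (G : Graph n) y → y * p k u x ≈ x →
    P (combEverywhere k G) u x ≈ p k u x ^ n * P G u y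
  P-combEverywhere {n} k G y yp≈x = begin
    P (combEverywhere k G) u x
      ≈⟨ P-combs k G (Vec.allFin n) ⟩
    W G (combWeight k (Vec.allFin n))
      ≈⟨ W-cong G (combWeight-allFin k) ⟩
    W G (λ _ → q)
      ≈⟨ Σ⊆-cong n (λ A → ≈-trans (*-congʳ (≈-sym (weight-const q y yp≈x A))) (*-assoc _ _ _)) ⟩
    Σ⊆ n (λ A → q ^ n * (y ^ ∣ A ∣ * u ^ rk (G [ A ])))
      ≈⟨ Σ⊆-*ˡ n (q ^ n) _ ⟩
    q ^ n * Σ⊆ n (λ A → y ^ ∣ A ∣ * u ^ rk (G [ A ]))
      ≈⟨ *-congˡ (Σ⊆-foldr n _) ⟨
    q ^ n * P G u y ∎
    where q = p k u x

-- Transport of `P` and `p` along ring homomorphisms.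

module Homomorphism (R S : CommutativeRing 0ℓ 0ℓ) where
  private
    module R = CommutativeRing R
    module S = CommutativeRing S
    module RE = Evaluation R
    module SE = Evaluation S
  open import Algebra.Morphism.Structures using (module RingMorphisms)
  open RingMorphisms R.rawRing S.rawRing using (IsRingHomomorphism)

  module _ {⟦_⟧ : R.Carrier → S.Carrier} (homo : IsRingHomomorphism ⟦_⟧) where
    open IsRingHomomorphism homo

    ^-homo : ∀ a n → ⟦ a RE.^ n ⟧ S.≈ ⟦ a ⟧ SE.^ n
    ^-homo a zero    = 1#-homo
    ^-homo a (suc n) = S.trans (*-homo a _) (S.*-congˡ (^-homo a n))

    p-homo : ∀ k u x → ⟦ RE.p k u x ⟧ S.≈ SE.p k ⟦ u ⟧ ⟦ x ⟧
    p-homo k u x = S.trans (+-homo _ _) (S.+-cong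
      (S.trans (*-homo _ _) (S.*-cong
        (S.trans (^-homo _ k) (^-congˡ k (S.trans (+-homo R.1# x) (S.+-congʳ 1#-homo))))
        (S.trans (+-homo _ R.1#) (S.+-cong xu² 1#-homo))))
      (S.trans (-‿homo _) (S.-‿cong xu²)))
      where
      open import Algebra.Properties.Semiring.Exp S.semiring using (^-congˡ)
      xu² : ⟦ x R.* u RE.^ 2 ⟧ S.≈ ⟦ x ⟧ S.* ⟦ u ⟧ SE.^ 2
      xu² = S.trans (*-homo x _) (S.*-congˡ (^-homo u 2))

    P-homo : ∀ {n} (G : Graph n) u x → ⟦ RE.P G u x ⟧ S.≈ SE.P G ⟦ u ⟧ ⟦ x ⟧
    P-homo {n} G u x = go (subsets n)
      where
      go : ∀ As → ⟦ List.foldr R._+_ R.0# (List.map (λ A → x RE.^ ∣ A ∣ R.* u RE.^ rk (G [ A ])) As) ⟧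
         S.≈ List.foldr S._+_ S.0# (List.map (λ A → ⟦ x ⟧ SE.^ ∣ A ∣ S.* ⟦ u ⟧ SE.^ rk (G [ A ])) As)
      go List.[]       = 0#-homo
      go (A List.∷ As) = S.trans (+-homo _ _) (S.+-cong
        (S.trans (*-homo _ _) (S.*-cong (^-homo x ∣ A ∣) (^-homo u (rk (G [ A ])))))
        (go As))

-- The embedding of a domain into its field of fractions.

module Fractions (D : IntegralDomain) where
  open IntegralDomain D hiding (refl; sym; trans)
  open IntegralDomain D using () renaming (sym to ≈-sym)
  open FieldOfFractions D
  open import Algebra.Morphism.Structures using (module RingMorphisms)
  open RingMorphisms rawRing (CommutativeRing.rawRing fractionField) using (IsRingHomomorphism)

  embed-isRingHomomorphism : IsRingHomomorphism embed
  embed-isRingHomomorphism = record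
    { isSemiringHomomorphism = record
      { isNearSemiringHomomorphism = record
        { +-isMonoidHomomorphism = record
          { isMagmaHomomorphism = record
            { isRelHomomorphism = record { cong = λ e → mk≈ᶠ (*-congʳ e) }
            ; homo = λ a b → mk≈ᶠ (*-cong (+-cong (≈-sym (*-identityʳ a)) (≈-sym (*-identityʳ b))) (*-identityˡ 1#))
            }
          ; ε-homo = ≈ᶠ-refl
          }
        ; *-homo = λ a b → mk≈ᶠ (*-congˡ (*-identityˡ 1#))
        }
      ; 1#-homo = ≈ᶠ-refl
      }
    ; -‿homo = λ _ → ≈ᶠ-refl
    }

  /-cancel : ∀ a b (b≉0 : ¬ (b ≈ 0#)) → (a / b ⟨ b≉0 ⟩) *ᶠ embed b ≈ᶠ embed a
  /-cancel a b b≉0 = mk≈ᶠ (*-assoc a b 1#)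

open Defs using (u; x; _≈_; _*_; _^_; embed)

mainTheorem6 : ∀ (n : ℕ) (G : Graph n) (k : ℕ) → k ≥ 1 →
    embed (Polynomials.P (combEverywhere k G) u x)
    ≈ embed (Polynomials.p k u x) ^ n * RationalFunctions.P G (embed u) (x/p k)
mainTheorem6 n G k _ = begin
  embed (Polynomials.P (combEverywhere k G) u x)
    -- The left side is a polynomial, whereas the quotient exists only among the rational functions,
    -- so evaluation is first moved through `embed`.
    ≈⟨ P-homo embed-isRingHomomorphism (combEverywhere k G) u x ⟩
  RationalFunctions.P (combEverywhere k G) (embed u) (embed x)
    ≈⟨ P-combEverywhere k G (x/p k) x/p-spec ⟩
  RationalFunctions.p k (embed u) (embed x) ^ n * RationalFunctions.P G (embed u) (x/p k)
    ≈⟨ *-congʳ {RationalFunctions.P G (embed u) (x/p k)} (^-congˡ n p-embed) ⟨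
  embed (Polynomials.p k u x) ^ n * RationalFunctions.P G (embed u) (x/p k) ∎
  where
  open CommutativeRing rationalFunctions using (*-congʳ; *-congˡ; semiring; setoid)
    renaming (sym to ≈-sym; trans to ≈-trans)
  open import Algebra.Properties.Semiring.Exp semiring using (^-congˡ)
  open import Relation.Binary.Reasoning.Setoid setoid
  open Homomorphism polynomialRing rationalFunctions
  open Fractions ℤ[u,x].polynomialDomain
  open WeightedPolynomial rationalFunctions (embed u) (embed x) using (P-combEverywhere)

  p-embed : embed (Polynomials.p k u x) ≈ RationalFunctions.p k (embed u) (embed x)
  p-embed = p-homo embed-isRingHomomorphism k u x

  x/p-spec : x/p k * RationalFunctions.p k (embed u) (embed x) ≈ embed x
  x/p-spec = ≈-trans (*-congˡ {x/p k} (≈-sym p-embed)) (/-cancel x (Polynomials.p k u x) (p≉0 k))
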